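{- Let $k$ be a positive integer that is not a perfect square, let $d$ be a positive rational number, and let $f(x)=\dfrac{dx+k}{x+d}$, acting on $\mathbb{R}\cup\{\infty\}$. The following are equivalent: (a) $R=\dfrac{4d^2}{k-d^2}$ is an integer; (b) some iterate $f^n(\infty)$ with $n\ge 1$ is a Pellian convergent of $\sqrt{k}$, i.e. equals $p/q$ with $p,q$ positive integers satisfying $p^2-kq^2=\pm1$; (c) infinitely many of the iterates $f^n(\infty)$, $n\ge1$, are continued fraction convergents of $\sqrt{k}$.
   Context: $f^n$ denotes the $n$-fold composite of $f$, and $f(\infty)=d$. If $\sqrt{k}=[c_0;c_1,c_2,\dots]$ is the simple continued fraction expansion of $\sqrt k$, its convergents are the rationals $[c_0;c_1,\dots,c_j]$, $j\ge0$. -}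

module Defs where

open import Data.Nat as ℕ using (ℕ; zero; suc)
open import Data.Integer as ℤ using (ℤ; +_)
open import Data.Rational as ℚ using (ℚ; _/_)
open import Data.Product using (_×_; _,_; Σ; ∃; ∃-syntax)
open import Data.Sum using (_⊎_)
open import Data.List using (List; []; _∷_)
open import Relation.Nullary using (¬_)
open import Relation.Binary.PropositionalEquality using (_≡_; _≢_)

ℕ→ℚ : ℕ → ℚ
ℕ→ℚ n = + n / 1

ℤ→ℚ : ℤ → ℚ
ℤ→ℚ z = z / 1

-- Points of ℚ ∪ {∞} in homogeneous coordinates: (p , q) stands for p/q,
-- with (p , 0) (p ≠ 0) standing for ∞.

-- f(x) = (d x + k)/(x + d) acting on homogeneous coordinates,
-- i.e. by the matrix [[d , k] , [1 , d]].
fAct : ℕ → ℚ → ℚ × ℚ → ℚ × ℚ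
fAct k d (p , q) = (d ℚ.* p ℚ.+ ℕ→ℚ k ℚ.* q , p ℚ.+ d ℚ.* q)

fIter : ℕ → ℚ → ℕ → ℚ × ℚ
fIter k d zero    = (ℚ.1ℚ , ℚ.0ℚ)
fIter k d (suc n) = fAct k d (fIter k d n)

PointEq : ℚ × ℚ → ℤ → ℤ → Set
PointEq (p , q) a b = (q ≢ ℚ.0ℚ) × ((b ≢ ℤ.0ℤ) × (p ℚ.* ℤ→ℚ b ≡ ℤ→ℚ a ℚ.* q))

-- Continued fraction expansion of √k.
-- A real number of the form (A + B√k)/C with A B C : ℤ is represented
-- by the triple (A , B , C).

QI : Set
QI = ℤ × ℤ × ℤ

-- u ≤ v·√k  (for integers u, v)
LeSqrt : ℕ → ℤ → ℤ → Set
LeSqrt k u v =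
  (ℤ.0ℤ ℤ.≤ v × (u ℤ.≤ ℤ.0ℤ ⊎ u ℤ.* u ℤ.≤ v ℤ.* v ℤ.* + k))
  ⊎ (v ℤ.< ℤ.0ℤ × (u ℤ.< ℤ.0ℤ × v ℤ.* v ℤ.* + k ℤ.≤ u ℤ.* u))

-- a ≤ (A + B√k)/C   (C ≠ 0),  i.e.  a C² - A C ≤ B C √k
LeQI : ℕ → ℤ → QI → Set
LeQI k a (A , B , C) = LeSqrt k (a ℤ.* C ℤ.* C ℤ.- A ℤ.* C) (B ℤ.* C)

IsFloor : ℕ → ℤ → QI → Set
IsFloor k a x@(A , B , C) =
  (C ≢ ℤ.0ℤ) × (LeQI k a x × ¬ LeQI k (a ℤ.+ ℤ.1ℤ) x)

subQI : QI → ℤ → QI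
subQI (A , B , C) a = (A ℤ.- a ℤ.* C , B , C)

-- 1/x :  C/(A + B√k) = (CA - CB√k)/(A² - B²k)
recQI : ℕ → QI → QI
recQI k (A , B , C) = (C ℤ.* A , ℤ.- (C ℤ.* B) , A ℤ.* A ℤ.- B ℤ.* B ℤ.* + k)

complete : ℕ → (ℕ → ℤ) → ℕ → QI
complete k c zero    = (ℤ.0ℤ , ℤ.1ℤ , ℤ.1ℤ)
complete k c (suc n) = recQI k (subQI (complete k c n) (c n))

IsCFExpansionSqrt : ℕ → (ℕ → ℤ) → Set
IsCFExpansionSqrt k c = ∀ n → IsFloor k (c n) (complete k c n)

-- [c₀; c₁, …, c_j] in homogeneous coordinates, evaluated as
-- c₀ + 1/(c₁ + 1/(⋯ + 1/c_j)), via x ↦ c + 1/x on pairs, starting at ∞.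
cfList : List ℤ → ℤ × ℤ
cfList []       = (ℤ.1ℤ , ℤ.0ℤ)
cfList (a ∷ as) with cfList as
... | (p , q) = (a ℤ.* p ℤ.+ q , p)

prefix : (ℕ → ℤ) → ℕ → List ℤ
prefix c j = go 0 (suc j)
  where
  go : ℕ → ℕ → List ℤ
  go i zero    = []
  go i (suc m) = c i ∷ go (suc i) m

convergent : (ℕ → ℤ) → ℕ → ℤ × ℤ
convergent c j = cfList (prefix c j)

IsConvergentSqrt : ℕ → ℚ × ℚ → Set
IsConvergentSqrt k x =
  Σ (ℕ → ℤ) λ c → IsCFExpansionSqrt k c ×
    ∃[ j ] (let (P , Q) = convergent c j in PointEq x P Q)

IsPellian : ℕ → ℚ × ℚ → Set
IsPellian k x = ∃[ p ] ∃[ q ]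
  ((0 ℕ.< p) × (0 ℕ.< q) ×
   ((+ p ℤ.* + p ℤ.- + k ℤ.* (+ q ℤ.* + q) ≡ ℤ.1ℤ
     ⊎ + p ℤ.* + p ℤ.- + k ℤ.* (+ q ℤ.* + q) ≡ ℤ.-1ℤ)
    × PointEq x (+ p) (+ q)))

{-# OPTIONS --safe #-}
module Submission where

-- Write d = a/b, α = a + b√k and N = a² − k b²; then fⁿ(∞) = x/y for αⁿ = x + y√k.
-- The unit u = α²/N has norm 1 and trace −(R + 2).
--
-- (a) ⇒ (b), (c) ⇒ (b).  In both cases infinitely many powers of α are proportional to
-- elements of ℤ[√k] of bounded norm: the elements N uⁿ if R is an integer, and the
-- convergents in case (c).  By the pigeonhole principle two of them have the same norm
-- up to sign and are congruent modulo it, so their quotient is a unit of ℤ[√k]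
-- proportional to a power of α.
--
-- (b) ⇒ (a).  If αⁿ is proportional to a unit of ℤ[√k], then uⁿ has an integral trace.
-- This trace is a monic integral polynomial in the trace of u, which is therefore an
-- integer.
--
-- (b) ⇒ (c).  All powers of a unit are units, and every solution of p² − k q² = ±1 is a
-- convergent: expressing (p , q) in the basis of two consecutive convergents, the
-- Euclidean algorithm runs through the continued fraction digits of √k.

open import Defs
open import Data.Nat as ℕ using (ℕ; zero; suc)
import Data.Nat.Properties as ℕ
open import Data.Nat.Coprimality using (Coprime; coprime-divisor)
open import Data.Nat.Divisibility using (_∣_; *-cancelʳ-∣; *-monoˡ-∣; ∣1⇒≡1)
open import Data.Nat.GCD using (gcd; gcd[m,n]∣m; gcd[m,n]∣n; gcd-greatest)
open import Data.Integer as ℤ using (ℤ; +_; -[1+_]; +[1+_]; 0ℤ; 1ℤ; -1ℤ; _+_; _*_; _-_; -_; _^_; _≤_; _<_; +≤+)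
import Data.Integer.Properties as ℤ
open import Data.Integer.Divisibility.Signed using (∣ᵤ⇒∣; divides; ∣⇒∣ᵤ)
open import Data.Integer.DivMod using (_/ℕ_; _%ℕ_; a≡a%ℕn+[a/ℕn]*n; n%ℕd<d)
open import Data.Integer.Tactic.RingSolver using (solve; solve-∀)
open import Data.Rational as ℚ using (ℚ; mkℚ; 0ℚ)
import Data.Rational.Properties as ℚ
open import Data.Rational.Solver using (module +-*-Solver)
open import Data.Rational.Unnormalised as ℚᵘ using (mkℚᵘ; *≡*)
import Data.Rational.Unnormalised.Properties as ℚᵘ
open import Data.Fin using (Fin; toℕ; fromℕ<; combine)
open import Data.Fin.Properties using (pigeonhole; combine-injective; toℕ-fromℕ<)
open import Data.List using (List; []; _∷_)
open import Data.Product using (_×_; _,_; Σ; ∃-syntax; proj₁; proj₂)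
open import Data.Sum using (_⊎_; inj₁; inj₂; [_,_]′)
open import Data.Empty using (⊥; ⊥-elim)
open import Function.Bundles using (_⇔_; mk⇔)
open import Relation.Nullary using (yes; no)
open import Relation.Binary.PropositionalEquality using (_≡_; _≢_; refl; sym; trans; cong; cong₂; subst; subst₂; module ≡-Reasoning)

-- Inequalities are proved by exhibiting the difference of the two sides as a
-- sum of products of non-negative terms.

-- R enters as the trace of u: u + 1/u = 2(a² + k b²)/(a² - k b²) = -(R + 2), so (a) says that u is
-- an algebraic integer. The numbers N uⁿ need not be units; the pigeonhole step repairs this. If w
-- and w′ have norm ±ρ and w′ ≡ w modulo ρ, then w′ times the conjugate of w is congruent to the
-- norm of w, hence divisible by ρ, and w′/w lies in ℤ[√k]. No real number occurs in the treatment
-- of continued fractions. For integers m and t ≥ 1 the floor of (m + √K)/t equals that of (m + b)/t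
-- with b = ⌊√K⌋, so every statement about digits becomes an integer inequality in b. The obstacle
-- in showing that a Pell solution is a convergent is that the Euclidean quotient can differ from
-- the digit of √K. A norm of ±1 leaves a single exception, a quotient one larger than the digit
-- with no remainder. It reflects the two expansions of a rational number, c + 1 = c + 1/1, and
-- costs one extra index.

infixl 6 _⊕_
infixl 7 _⊗_

_⊕_ : ∀ {x y} → 0ℤ ≤ x → 0ℤ ≤ y → 0ℤ ≤ x + y
_⊕_ = ℤ.+-mono-≤

_⊗_ : ∀ {x y} → 0ℤ ≤ x → 0ℤ ≤ y → 0ℤ ≤ x * y
_⊗_ {+ m} {+ n} _ _ = subst (0ℤ ≤_) (ℤ.pos-* m n) (+≤+ ℕ.z≤n)

0≤+ : ∀ {n} → 0ℤ ≤ + n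
0≤+ = +≤+ ℕ.z≤n

by-certificate : ∀ {x y} → 0ℤ ≤ x → x ≡ y → 0ℤ ≤ y
by-certificate p refl = p

-- Proofs by contradiction have the same form: the assumed inequalities combine to a sum of
-- non-negative terms that the ring solver evaluates to -1. This works because x < 0 is recorded
-- over ℤ as 0 ≤ -x - 1.
refute : ∀ {x} → 0ℤ ≤ x → x ≡ -1ℤ → ⊥
refute () refl

sign-split : ∀ x → 0ℤ ≤ x ⊎ 0ℤ ≤ - x - 1ℤ
sign-split (+ n)      = inj₁ 0≤+
sign-split (-[1+ n ]) = inj₂ 0≤+

by-sign : ∀ {y} x → (0ℤ ≤ x → 0ℤ ≤ y) → (0ℤ ≤ - x - 1ℤ → 0ℤ ≤ y) → 0ℤ ≤ y
by-sign x f g = [ f , g ]′ (sign-split x)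

by-contradiction : ∀ {x} → (0ℤ ≤ - x - 1ℤ → ⊥) → 0ℤ ≤ x
by-contradiction {x} f = by-sign x (λ p → p) (λ p → ⊥-elim (f p))

≤⇒0≤ : ∀ {x y} → x ≤ y → 0ℤ ≤ y - x
≤⇒0≤ = ℤ.i≤j⇒0≤j-i

0≤⇒≤ : ∀ {x y} → 0ℤ ≤ y - x → x ≤ y
0≤⇒≤ = ℤ.0≤i-j⇒j≤i

<⇒0≤ : ∀ {x y} → x < y → 0ℤ ≤ y - x - 1ℤ
<⇒0≤ {x} {y} p = by-certificate (≤⇒0≤ {1ℤ + x} (ℤ.i<j⇒suc[i]≤j p)) (solve (x ∷ y ∷ []))

weaken : ∀ x → 0ℤ ≤ x - 1ℤ → 0ℤ ≤ x
weaken x p = by-certificate (p ⊕ 0≤+ {1}) (solve (x ∷ []))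

positive-cofactor : ∀ t e → 0ℤ ≤ t → 0ℤ ≤ t * e - 1ℤ → 0ℤ ≤ e - 1ℤ
positive-cofactor t e 0≤t te≥1 =
  by-contradiction λ e<1 → refute (te≥1 ⊕ 0≤t ⊗ e<1) (solve (t ∷ e ∷ []))

1≤square : ∀ v → 0ℤ ≤ v - 1ℤ → 0ℤ ≤ v * v - 1ℤ
1≤square v p = by-certificate (p ⊗ p ⊕ p ⊕ p) (solve (v ∷ []))

1≤product : ∀ x y → 0ℤ ≤ x - 1ℤ → 0ℤ ≤ y - 1ℤ → 0ℤ ≤ x * y - 1ℤ
1≤product x y p q = by-certificate (p ⊗ q ⊕ p ⊕ q) (solve (x ∷ y ∷ []))

≥1⇒≢0 : ∀ {x} → 0ℤ ≤ x - 1ℤ → x ≢ 0ℤ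
≥1⇒≢0 () refl

antisymmetric : ∀ {x y} → 0ℤ ≤ x - y → 0ℤ ≤ y - x → x ≡ y
antisymmetric p q = ℤ.≤-antisym (0≤⇒≤ q) (0≤⇒≤ p)

-- Continued fraction expansion of √K

-- `b` is ⌊√K⌋; the strict inequality in `b²<K` excludes perfect squares.
record IsRoot (K b : ℤ) : Set where
  field
    b≥1  : 0ℤ ≤ b - 1ℤ
    b²<K : 0ℤ ≤ K - b * b - 1ℤ
    K<   : 0ℤ ≤ (b + 1ℤ) * (b + 1ℤ) - K - 1ℤ

-- A complete quotient (m + √K)/t of √K, with t s = K − m² and b = ⌊√K⌋.
record Reduced (K b m t s : ℤ) : Set where
  field
    t≥1   : 0ℤ ≤ t - 1ℤ
    s≥1   : 0ℤ ≤ s - 1ℤ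
    m≥0   : 0ℤ ≤ m
    m≤b   : 0ℤ ≤ b - m
    t≤b+m : 0ℤ ≤ b + m - t
    ts    : K ≡ t * s + m * m

-- c = ⌊(m + √K)/t⌋
record Floor (b c m t : ℤ) : Set where
  field
    below : 0ℤ ≤ b - (c * t - m)
    above : 0ℤ ≤ (c + 1ℤ) * t - m - b - 1ℤ

√-reduced : ∀ {K b} → IsRoot K b → Reduced K b 0ℤ 1ℤ K
√-reduced {K} {b} root = record
  { t≥1   = 0≤+
  ; s≥1   = by-certificate (b²<K ⊕ weaken b b≥1 ⊗ weaken b b≥1) (solve (K ∷ b ∷ []))
  ; m≥0   = 0≤+
  ; m≤b   = by-certificate (weaken b b≥1) (solve (b ∷ []))
  ; t≤b+m = by-certificate b≥1 (solve (b ∷ []))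
  ; ts    = solve (K ∷ [])
  }
  where open IsRoot root

-- If t ≤ b, then `above` gives c t - m > b - t ≥ 0. If t > b, then t > m, and c ≥ 1 is enough.
step-m≥1 : ∀ {K b c m t s} → Reduced K b m t s → Floor b c m t → 0ℤ ≤ c * t - m - 1ℤ
step-m≥1 {K} {b} {c} {m} {t} red fl =
  by-sign (b - t)
    (λ t≤b → by-certificate (above ⊕ t≤b) (solve (b ∷ c ∷ m ∷ t ∷ [])))
    (λ b<t → by-certificate (c≥1 ⊗ weaken t t≥1 ⊕ b<t ⊕ m≤b) (solve (b ∷ c ∷ m ∷ t ∷ [])))
  where
  open Reduced red
  open Floor fl
  c≥1 : 0ℤ ≤ c - 1ℤ
  c≥1 = positive-cofactor t c (weaken t t≥1)
          (by-certificate (above ⊕ t≤b+m) (solve (b ∷ c ∷ m ∷ t ∷ [])))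

-- The new complete quotient is 1/((m + √K)/t − c).
step-reduced : ∀ {K b c m t s} → IsRoot K b → Reduced K b m t s → Floor b c m t →
  Reduced K b (c * t - m) (s + + 2 * (c * m) - c * c * t) t
step-reduced {K} {b} {c} {m} {t} {s} root red@(record { ts = refl }) fl = record
  -- The old `t` times the new one is K minus the square of the new `m`, which is positive since the
  -- new `m` is at most b and b² < K.
  { t≥1   = positive-cofactor t (s + + 2 * (c * m) - c * c * t) (weaken t t≥1)
              (by-certificate (b²<K ⊕ below ⊗ b+m'≥0) (solve (b ∷ c ∷ m ∷ t ∷ s ∷ [])))
  ; s≥1   = t≥1
  ; m≥0   = weaken (c * t - m) m'≥1
  ; m≤b   = below
  -- Write m′ and t′ for the new values. By `above`, b + 1 - m′ ≤ t, so t t′ = K - m′² < (b + 1 -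
  -- m′)(b + 1 + m′) ≤ t (b + 1 + m′); cancel t.
  ; t≤b+m = by-certificate
              (positive-cofactor t (b + 1ℤ + (c * t - m) - (s + + 2 * (c * m) - c * c * t))
                (weaken t t≥1)
                (by-certificate (K< ⊕ above ⊗ (b+m'≥0 ⊕ 0≤+ {1})) (solve (b ∷ c ∷ m ∷ t ∷ s ∷ []))))
              (solve (b ∷ c ∷ m ∷ t ∷ s ∷ []))
  ; ts    = solve (b ∷ c ∷ m ∷ t ∷ s ∷ [])
  }
  where
  open IsRoot root
  open Reduced red
  open Floor fl
  m'≥1 : 0ℤ ≤ c * t - m - 1ℤ
  m'≥1 = step-m≥1 red fl
  b+m'≥0 : 0ℤ ≤ b + (c * t - m)
  b+m'≥0 = weaken b b≥1 ⊕ weaken (c * t - m) m'≥1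

-- With b = ⌊√K⌋, t is the integer part of m + √K, so (m + √K)/t lies between 1 and 2.
digit-one : ∀ {b c m t} → 0ℤ ≤ t - 1ℤ → t ≡ b + m → Floor b c m t → c ≡ 1ℤ
digit-one {b} {c} {m} t≥1 refl fl = antisymmetric
  (positive-cofactor (b + m) c (weaken (b + m) t≥1) (by-certificate above (solve (b ∷ c ∷ m ∷ []))))
  (by-certificate
    (positive-cofactor (b + m) (+ 2 - c) (weaken (b + m) t≥1)
      (by-certificate (below ⊕ t≥1) (solve (b ∷ c ∷ m ∷ []))))
    (solve (c ∷ [])))
  where open Floor fl

-- F = ± N(P + Q√K) when P/Q has coordinates (u , v) in the basis formed by two
-- consecutive convergents.  If F = ±1, then the Euclidean algorithm on (u , v)
-- reproduces the continued fraction digits: here c is the quotient of u by v.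
module _ {K b c m t s u v F : ℤ} (root : IsRoot K b)
  (red : Reduced K b m t s) (fl : Floor b c m t)
  (u≥1 : 0ℤ ≤ u - 1ℤ) (v≥1 : 0ℤ ≤ v - 1ℤ)
  (F≡ : F ≡ t * (u * u) - + 2 * (m * (u * v)) - s * (v * v))
  (-1≤F : 0ℤ ≤ F + 1ℤ) (F≤1 : 0ℤ ≤ 1ℤ - F)
  where
  open IsRoot root
  open Reduced red
  open Floor fl

  private
    m′ t′ e : ℤ
    m′ = c * t - m
    t′ = s + + 2 * (c * m) - c * c * t
    e = u - c * v
    red′ : Reduced K b m′ t′ t
    red′ = step-reduced root red fl
    0≤u : 0ℤ ≤ u
    0≤u = weaken u u≥1
    0≤v : 0ℤ ≤ v
    0≤v = weaken v v≥1
    0≤t : 0ℤ ≤ t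
    0≤t = weaken t t≥1

  -- F = u (t u - m v) - m u v - s v², and a negative bracket would make this at most -2.
  slope-nonneg : 0ℤ ≤ t * u - m * v
  slope-nonneg = by-contradiction λ y<0 → refute
    (-1≤F ⊕ 0≤u ⊗ y<0 ⊕ u≥1 ⊕ m≥0 ⊗ (0≤u ⊗ 0≤v) ⊕ 1≤product s (v * v) s≥1 (1≤square v v≥1))
    (trans (cong (λ z → z + 1ℤ + u * (- (t * u - m * v) - 1ℤ) + (u - 1ℤ) + m * (u * v) + (s * (v * v) - 1ℤ)) F≡)
           (solve (m ∷ t ∷ s ∷ u ∷ v ∷ [])))

  -- In the next basis the coordinates are (v , e), and F = -t′ v² + m′ v e + e (t u - m v). For e <
  -- 0 the first two terms are at most -1 each and the last is at most 0, so F ≤ -2.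
  remainder-nonneg : 0ℤ ≤ u - c * v
  remainder-nonneg = by-contradiction λ e<0 → refute
    (-1≤F ⊕ 1≤product t′ (v * v) (Reduced.t≥1 red′) (1≤square v v≥1)
      ⊕ 1≤product (m′ * v) (- e) (1≤product m′ v (step-m≥1 red fl) v≥1) e<0
      ⊕ weaken (- e) e<0 ⊗ slope-nonneg)
    (trans (cong (λ z → z + 1ℤ + ((s + + 2 * (c * m) - c * c * t) * (v * v) - 1ℤ)
                       + ((c * t - m) * v * - (u - c * v) - 1ℤ) + - (u - c * v) * (t * u - m * v)) F≡)
           (solve (c ∷ m ∷ t ∷ s ∷ u ∷ v ∷ [])))

  -- The exceptional case: the Euclidean quotient of u by v exceeds the digit c. Then e = v, so u/v
  -- = c + 1 = c + 1/1, and the next digit of √K is shown to be that 1.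
  module _ (v≤e : 0ℤ ≤ u - c * v - v) where

    private
      m″ w : ℤ
      m″ = (c + 1ℤ) * t - m
      w = u - c * v - v
      m″≥1 : 0ℤ ≤ m″ - 1ℤ
      m″≥1 = by-certificate {m″ - b - 1ℤ + b} (above ⊕ weaken b b≥1) (identity m″ b)
        where
        identity : ∀ x b → x - b - 1ℤ + b ≡ x - 1ℤ
        identity = solve-∀
      K≤m″² : 0ℤ ≤ m″ * m″ - K
      K≤m″² = by-certificate
        (above ⊗ (weaken m″ m″≥1 ⊕ (weaken b b≥1 ⊕ 0≤+ {1})) ⊕ K< ⊕ 0≤+ {1}) (identity m″ b K)
        where
        identity : ∀ x b K → (x - b - 1ℤ) * (x + (b + 1ℤ)) + ((b + 1ℤ) * (b + 1ℤ) - K - 1ℤ) + 1ℤ ≡ x * x - K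
        identity = solve-∀

      -- t F = (t u - m v)² - K v², and t u - m v = t w + m″ v. Hence t F = t² w² + 2 t w m″ v +
      -- (m″² - K) v², where m″² ≥ K; so w ≥ 1 would contradict F ≤ 1.
      w≤0 : 0ℤ ≤ - w
      w≤0 = by-contradiction λ w>0 → refute
        (0≤t ⊗ F≤1 ⊕ K≤m″² ⊗ (0≤v ⊗ 0≤v)
          ⊕ (0≤t ⊕ 0≤t) ⊗ 1≤product (m″ * v) w (1≤product m″ v m″≥1 v≥1) (by-certificate w>0 (neg-neg w))
          ⊕ (0≤t ⊗ v≤e) ⊗ (0≤t ⊗ v≤e) ⊕ t≥1)
        (trans (cong₂ (λ z k → t * (1ℤ - z) + (((c + 1ℤ) * t - m) * ((c + 1ℤ) * t - m) - k) * (v * v)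
                       + (t + t) * (((c + 1ℤ) * t - m) * v * (u - c * v - v) - 1ℤ)
                       + t * (u - c * v - v) * (t * (u - c * v - v)) + (t - 1ℤ)) F≡ ts)
               (solve (c ∷ m ∷ t ∷ s ∷ u ∷ v ∷ [])))
        where
        neg-neg : ∀ x → - (- x) - 1ℤ ≡ x - 1ℤ
        neg-neg = solve-∀

    remainder-overflow : u - c * v ≡ v
    remainder-overflow = antisymmetric v≤e (by-certificate w≤0 (neg-sub (u - c * v) v))
      where
      neg-sub : ∀ x y → - (x - y) ≡ y - x
      neg-sub = solve-∀

    -- For e = v the form is F = v² (t + 2 m′ - t′). The bracket is 1 plus the two non-negative
    -- quantities t + m′ - b - 1 and b + m′ - t′, so F ≤ 1 makes both vanish.
    overflow-next-t : s + + 2 * (c * m) - c * c * t ≡ b + (c * t - m)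
    overflow-next-t = sym (antisymmetric (Reduced.t≤b+m red′) (by-certificate
      (F≤1 ⊕ 1≤square v v≥1 ⊗ (above ⊕ Reduced.t≤b+m red′ ⊕ 0≤+ {1}) ⊕ above)
      (trans (cong (λ z → 1ℤ - z + (v * v - 1ℤ) * ((c + 1ℤ) * t - m - b - 1ℤ + (b + (c * t - m) - (s + + 2 * (c * m) - c * c * t)) + 1ℤ)
                        + ((c + 1ℤ) * t - m - b - 1ℤ))
                   (trans F≡ (cong (λ z → t * (z * z) - + 2 * (m * (z * v)) - s * (v * v)) u≡)))
             (solve (b ∷ c ∷ m ∷ t ∷ s ∷ v ∷ [])))))
      where
      u≡ : u ≡ (c + 1ℤ) * v
      u≡ = trans (trans (split u c v) (cong (_+ c * v) remainder-overflow)) (join c v)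
        where
        split : ∀ u c v → u ≡ u - c * v + c * v
        split = solve-∀
        join : ∀ c v → v + c * v ≡ (c + 1ℤ) * v
        join = solve-∀

    overflow-next-digit : ∀ {c′} → Floor b c′ (c * t - m) (s + + 2 * (c * m) - c * c * t) → c′ ≡ 1ℤ
    overflow-next-digit = digit-one (Reduced.t≥1 red′) overflow-next-t

-- Complete quotients, continuants and the norms of convergents

record Surd : Set where
  constructor ⟨_,_,_⟩
  field
    m t s : ℤ

open Surd

step : ℤ → Surd → Surd
step c ⟨ m , t , s ⟩ = ⟨ c * t - m , s + + 2 * (c * m) - c * c * t , t ⟩

quotient : ℤ → (ℕ → ℤ) → ℕ → Surd
quotient K c zero    = ⟨ 0ℤ , 1ℤ , K ⟩
quotient K c (suc n) = step (c n) (quotient K c n)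

quotient-ts : ∀ K c n → let x = quotient K c n in K ≡ t x * s x + m x * m x
quotient-ts K c zero    = identity K
  where
  identity : ∀ K → K ≡ 1ℤ * K + 0ℤ * 0ℤ
  identity = solve-∀
quotient-ts K c (suc n) = trans (quotient-ts K c n) (identity (c n) (m x) (t x) (s x))
  where
  x = quotient K c n
  identity : ∀ c m t s →
    t * s + m * m ≡ (s + + 2 * (c * m) - c * c * t) * t + (c * t - m) * (c * t - m)
  identity = solve-∀

-- With seeds (1 , 0) and (0 , 1): the numerators and the denominators of the
-- convergents [c₀; …, c_{n-1}] and [c₀; …, c_{n-2}].
continuant : (ℕ → ℤ) → ℤ × ℤ → ℕ → ℤ × ℤ
continuant c x zero    = x
continuant c x (suc n) = let (y , y′) = continuant c x n in c n * y + y′ , y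

p p′ q q′ : (ℕ → ℤ) → ℕ → ℤ
p  c n = proj₁ (continuant c (1ℤ , 0ℤ) n)
p′ c n = proj₂ (continuant c (1ℤ , 0ℤ) n)
q  c n = proj₁ (continuant c (0ℤ , 1ℤ) n)
q′ c n = proj₂ (continuant c (0ℤ , 1ℤ) n)

segment : (ℕ → ℤ) → ℕ → ℕ → List ℤ
segment c i zero    = []
segment c i (suc l) = c i ∷ segment c (suc i) l

-- The left-hand side of go≡segment is the local function go of prefix, which
-- has no name here: it is recovered by unification from prefix≡segment.
mutual
  go≡segment : ∀ c j i l → _ ≡ segment c i l
  go≡segment c j i zero    = refl
  go≡segment c j i (suc l) = cong (c i ∷_) (go≡segment c j (suc i) l)

  prefix≡segment : ∀ c j → prefix c j ≡ segment c 0 (suc j)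
  prefix≡segment c zero = refl
  -- Two digits are unfolded and `suc j` and `2` abstracted, so that the remaining call of `go` is
  -- applied to distinct variables and unification determines it.
  prefix≡segment c (suc j) with suc j | 2
  ... | j′ | i = cong (λ as → c 0 ∷ c 1 ∷ as) (go≡segment c j′ i j)

-- `continuant` absorbs digits from the left, `cfList` from the right; the value y P + y′ Q does not
-- change when the digit at the boundary moves from one to the other.
cfList-segment : ∀ c x n l →
  let (y , y′) = continuant c x n ; (P , Q) = cfList (segment c n l)
  in y * P + y′ * Q ≡ proj₁ (continuant c x (n ℕ.+ l))
cfList-segment c x n zero = trans
  (identity (proj₁ (continuant c x n)) (proj₂ (continuant c x n)))
  (cong (λ i → proj₁ (continuant c x i)) (sym (ℕ.+-identityʳ n)))
  where
  identity : ∀ y y′ → y * 1ℤ + y′ * 0ℤ ≡ y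
  identity = solve-∀
cfList-segment c x n (suc l) = trans (identity (c n) _ _ _ _)
  (trans (cfList-segment c x (suc n) l) (cong (λ i → proj₁ (continuant c x i)) (sym (ℕ.+-suc n l))))
  where
  identity : ∀ c y y′ P Q → y * (c * P + Q) + y′ * P ≡ (c * y + y′) * P + y * Q
  identity = solve-∀

convergent≡ : ∀ c j → convergent c j ≡ (p c (suc j) , q c (suc j))
convergent≡ c j = trans (cong cfList (prefix≡segment c j)) (cong₂ _,_
  (trans (first (proj₁ x) (proj₂ x)) (cfList-segment c (1ℤ , 0ℤ) 0 (suc j)))
  (trans (second (proj₁ x) (proj₂ x)) (cfList-segment c (0ℤ , 1ℤ) 0 (suc j))))
  where
  x = cfList (segment c 0 (suc j))
  first : ∀ P Q → P ≡ 1ℤ * P + 0ℤ * Q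
  first = solve-∀
  second : ∀ P Q → Q ≡ 0ℤ * P + 1ℤ * Q
  second = solve-∀

alternating : ℕ → ℤ
alternating zero    = 1ℤ
alternating (suc n) = - alternating n

alternating-unit : ∀ n → alternating n ≡ 1ℤ ⊎ alternating n ≡ -1ℤ
alternating-unit zero    = inj₁ refl
alternating-unit (suc n) with alternating-unit n
... | inj₁ eq = inj₂ (cong -_ eq)
... | inj₂ eq = inj₁ (cong -_ eq)

module _ (K : ℤ) (c : ℕ → ℤ) where

  -- The matrix of the norm form in the basis of two consecutive convergents, so that the norm at
  -- coordinates (u , v) is (-1)ⁿ (t u² - 2 m u v - s v²). The mixed entry `pp′` is what lets the
  -- induction close.
  record NormMatrix (n : ℕ) : Set where
    field
      pp   : p c n * p c n - K * (q c n * q c n) ≡ alternating n * t (quotient K c n)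
      pp′  : p c n * p′ c n - K * (q c n * q′ c n) ≡ - (alternating n * m (quotient K c n))
      p′p′ : p′ c n * p′ c n - K * (q′ c n * q′ c n) ≡ - (alternating n * s (quotient K c n))

  normMatrix : ∀ n → NormMatrix n
  normMatrix zero = record { pp = start K ; pp′ = start′ K ; p′p′ = start″ K }
    where
    start : ∀ K → 1ℤ * 1ℤ - K * (0ℤ * 0ℤ) ≡ 1ℤ * 1ℤ
    start = solve-∀
    start′ : ∀ K → 1ℤ * 0ℤ - K * (0ℤ * 1ℤ) ≡ - (1ℤ * 0ℤ)
    start′ = solve-∀
    start″ : ∀ K → 0ℤ * 0ℤ - K * (1ℤ * 1ℤ) ≡ - (1ℤ * K)
    start″ = solve-∀
  normMatrix (suc n) = record
    { pp   = trans (expand K (c n) (p c n) (p′ c n) (q c n) (q′ c n))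
               (trans (cong₂ (λ x y → c n * c n * x + y) pp (cong₂ (λ x y → + 2 * c n * x + y) pp′ p′p′))
                 (collect (alternating n) (c n) (m x) (t x) (s x)))
    ; pp′  = trans (expand′ K (c n) (p c n) (p′ c n) (q c n) (q′ c n))
               (trans (cong₂ (λ x y → c n * x + y) pp pp′) (collect′ (alternating n) (c n) (m x) (t x)))
    ; p′p′ = trans pp (collect″ (alternating n) (t x))
    }
    where
    open NormMatrix (normMatrix n)
    x = quotient K c n
    expand : ∀ K c p p′ q q′ → (c * p + p′) * (c * p + p′) - K * ((c * q + q′) * (c * q + q′))
      ≡ c * c * (p * p - K * (q * q)) + (+ 2 * c * (p * p′ - K * (q * q′)) + (p′ * p′ - K * (q′ * q′)))
    expand = solve-∀
    collect : ∀ ε c m t s → c * c * (ε * t) + (+ 2 * c * - (ε * m) + - (ε * s))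
      ≡ - ε * (s + + 2 * (c * m) - c * c * t)
    collect = solve-∀
    expand′ : ∀ K c p p′ q q′ → (c * p + p′) * p - K * ((c * q + q′) * q)
      ≡ c * (p * p - K * (q * q)) + (p * p′ - K * (q * q′))
    expand′ = solve-∀
    collect′ : ∀ ε c m t → c * (ε * t) + - (ε * m) ≡ - (- ε * (c * t - m))
    collect′ = solve-∀
    collect″ : ∀ ε t → ε * t ≡ - (- ε * t)
    collect″ = solve-∀

  Digits : ℤ → Set
  Digits b = ∀ n → Floor b (c n) (m (quotient K c n)) (t (quotient K c n))

  ReducedAt : ℤ → ℕ → Set
  ReducedAt b n = let x = quotient K c n in Reduced K b (m x) (t x) (s x)

  digits-reduced : ∀ {b} → IsRoot K b → Digits b → ∀ n → ReducedAt b n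
  digits-reduced root fl zero    = √-reduced root
  digits-reduced root fl (suc n) = step-reduced root (digits-reduced root fl n) (fl n)

-- The Euclidean algorithm on a Pell solution

module _ {K b : ℤ} {c : ℕ → ℤ} (root : IsRoot K b) (fl : Digits K c b) {P Q : ℤ} where

  IsMultiple : Set
  IsMultiple = ∃[ j ] ∃[ w ] (P ≡ w * p c (suc j) × Q ≡ w * q c (suc j))

  -- The second coordinate drops from v to the remainder e < v at each call, and `fuel` bounds it.
  -- The form changes sign with each change of basis, which is why F is bounded on both sides.
  euclid : (fuel n : ℕ) (u v : ℤ) → let x = quotient K c n in
    0ℤ ≤ u - 1ℤ → 0ℤ ≤ v - 1ℤ → 0ℤ ≤ + fuel - v →
    P ≡ u * p c n + v * p′ c n → Q ≡ u * q c n + v * q′ c n →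
    (F : ℤ) → F ≡ t x * (u * u) - + 2 * (m x * (u * v)) - s x * (v * v) →
    0ℤ ≤ F + 1ℤ → 0ℤ ≤ 1ℤ - F → IsMultiple
  euclid zero n u v _ v≥1 v≤0 = ⊥-elim (refute (v≥1 ⊕ v≤0) (solve (v ∷ [])))
  euclid (suc fuel) n u v u≥1 v≥1 v≤fuel P≡ Q≡ F F≡ -1≤F F≤1 =
    [ (λ e≥v → overflow e≥v) , (λ e<v → compare e<v (sign-split (e - 1ℤ))) ]′ (sign-split (e - v))
    where
    x = quotient K c n
    red : ReducedAt K c b n
    red = digits-reduced K c root fl n
    e : ℤ
    e = u - c n * v
    e≥0 : 0ℤ ≤ e
    e≥0 = remainder-nonneg {u = u} {v} root red (fl n) u≥1 v≥1 F≡ -1≤F F≤1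

    move : ∀ c u v y y′ → u * y + v * y′ ≡ v * (c * y + y′) + (u - c * v) * y
    move = solve-∀

    P≡′ : P ≡ v * p c (suc n) + e * p′ c (suc n)
    P≡′ = trans P≡ (move (c n) u v (p c n) (p′ c n))
    Q≡′ : Q ≡ v * q c (suc n) + e * q′ c (suc n)
    Q≡′ = trans Q≡ (move (c n) u v (q c n) (q′ c n))

    compare : 0ℤ ≤ - (e - v) - 1ℤ → 0ℤ ≤ e - 1ℤ ⊎ 0ℤ ≤ - (e - 1ℤ) - 1ℤ → IsMultiple
    -- The remainder is 0, so the algorithm stops with (P , Q) equal to v times the newest
    -- convergent.
    compare e<v (inj₂ e<1) = n , v , trans P≡′ (drop _) , trans Q≡′ (drop _)
      where
      e≡0 : e ≡ 0ℤ
      e≡0 = antisymmetric (by-certificate e≥0 (sub0 e)) (by-certificate e<1 (flip e))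
        where
        sub0 : ∀ x → x ≡ x - 0ℤ
        sub0 = solve-∀
        flip : ∀ x → - (x - 1ℤ) - 1ℤ ≡ 0ℤ - x
        flip = solve-∀
      drop : ∀ {y} z → y + e * z ≡ y
      drop {y} z = trans (cong (λ a → y + a * z) e≡0) (solve (y ∷ z ∷ []))
    compare e<v (inj₁ e≥1) = euclid fuel (suc n) v e v≥1 e≥1
      (by-certificate (v≤fuel ⊕ e<v) (fuel-step (+ fuel) v e)) P≡′ Q≡′ (- F)
      (trans (cong -_ F≡) (form-step (c n) (m x) (t x) (s x) u v))
      (by-certificate F≤1 (solve (F ∷ []))) (by-certificate -1≤F (solve (F ∷ [])))
      where
      fuel-step : ∀ f v e → 1ℤ + f - v + (- (e - v) - 1ℤ) ≡ f - e
      fuel-step = solve-∀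
      form-step : ∀ c m t s u v → - (t * (u * u) - + 2 * (m * (u * v)) - s * (v * v)) ≡
        (s + + 2 * (c * m) - c * c * t) * (v * v) - + 2 * ((c * t - m) * (v * (u - c * v)))
        - t * ((u - c * v) * (u - c * v))
      form-step = solve-∀

    overflow : 0ℤ ≤ e - v → IsMultiple
    -- Here e = v and the digit after `c n` is 1, so the sum of the two convergents is the next
    -- convergent: the index is one larger than in the regular case.
    overflow e≥v = suc n , v , trans P≡′ (shift _ _) , trans Q≡′ (shift _ _)
      where
      e≡v : e ≡ v
      e≡v = remainder-overflow {u = u} {v} root red (fl n) u≥1 v≥1 F≡ -1≤F F≤1 e≥v
      c′≡1 : c (suc n) ≡ 1ℤ
      c′≡1 = overflow-next-digit {u = u} {v} root red (fl n) u≥1 v≥1 F≡ -1≤F F≤1 e≥v (fl (suc n))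
      shift : ∀ y z → v * y + e * z ≡ v * (c (suc n) * y + z)
      shift y z = trans (cong (λ a → v * y + a * z) e≡v)
        (trans (identity v y z) (cong (λ a → v * (a * y + z)) (sym c′≡1)))
        where
        identity : ∀ v y z → v * y + v * z ≡ v * (1ℤ * y + z)
        identity = solve-∀

  -- At index 0 the basis is (1 , 0), (0 , 1): the coordinates are P and Q themselves and F is the
  -- Pell norm.
  pell-multiple : 0ℤ ≤ P - 1ℤ → 0ℤ ≤ Q - 1ℤ →
    0ℤ ≤ P * P - K * (Q * Q) + 1ℤ → 0ℤ ≤ 1ℤ - (P * P - K * (Q * Q)) → IsMultiple
  pell-multiple P≥1 Q≥1 = euclid ℤ.∣ Q ∣ 0 P Q P≥1 Q≥1
    (by-certificate (+≤+ (ℕ.z≤n {0})) (trans (sym (ℤ.+-inverseʳ Q)) (cong (_- Q) (sym (ℤ.0≤i⇒+∣i∣≡i (weaken Q Q≥1))))))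
    (first P Q) (second P Q) _ (form K P Q)
    where
    first : ∀ P Q → P ≡ P * 1ℤ + Q * 0ℤ
    first = solve-∀
    second : ∀ P Q → Q ≡ P * 0ℤ + Q * 1ℤ
    second = solve-∀
    form : ∀ K P Q → P * P - K * (Q * Q) ≡ 1ℤ * (P * P) - + 2 * (0ℤ * (P * Q)) - K * (Q * Q)
    form = solve-∀

-- Comparison of `IsFloor` with the integer condition `Floor`

module _ {k : ℕ} {b : ℤ} (root : IsRoot (+ k) b) where
  open IsRoot root

  -- Dividing by w > 0 turns the hypothesis into x ≤ √k, and an integer below √k is at most ⌊√k⌋ =
  -- b.
  LeSqrt⇒≤ : ∀ w x → 0ℤ ≤ w - 1ℤ → LeSqrt k (w * x) w → 0ℤ ≤ b - x
  LeSqrt⇒≤ w x w≥1 (inj₁ (_ , inj₁ wx≤0)) = by-contradiction λ b<x → refute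
    (1≤product w x w≥1 (by-certificate (b<x ⊕ weaken b b≥1) (solve (b ∷ x ∷ []))) ⊕ ≤⇒0≤ wx≤0)
    (solve (w ∷ x ∷ []))
  LeSqrt⇒≤ w x w≥1 (inj₁ (_ , inj₂ w²x²≤w²k)) = by-contradiction λ b<x → refute
    (≤⇒0≤ w²x²≤w²k ⊕ 0≤w² ⊗ (K< ⊕ b<x ⊗ (b<x ⊕ (0≤b+1 ⊕ 0≤b+1))) ⊕ 1≤square w w≥1)
    (identity (+ k) b w x)
    where
    0≤b+1 : 0ℤ ≤ b + 1ℤ
    0≤b+1 = weaken b b≥1 ⊕ 0≤+ {1}
    0≤w² : 0ℤ ≤ w * w
    0≤w² = weaken w w≥1 ⊗ weaken w w≥1
    identity : ∀ K b w x →
      w * w * K - w * x * (w * x)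
        + w * w * ((b + 1ℤ) * (b + 1ℤ) - K - 1ℤ
                   + (- (b - x) - 1ℤ) * (- (b - x) - 1ℤ + (b + 1ℤ + (b + 1ℤ))))
        + (w * w - 1ℤ) ≡ -1ℤ
    identity = solve-∀
  LeSqrt⇒≤ w x w≥1 (inj₂ (w<0 , _)) =
    ⊥-elim (refute (w≥1 ⊕ <⇒0≤ w<0 ⊕ 0≤+ {1}) (identity w))
    where
    identity : ∀ w → w - 1ℤ + (0ℤ - w - 1ℤ) + 1ℤ ≡ -1ℤ
    identity = solve-∀

  ≤⇒LeSqrt : ∀ w x → 0ℤ ≤ w - 1ℤ → 0ℤ ≤ b - x → LeSqrt k (w * x) w
  ≤⇒LeSqrt w x w≥1 x≤b = inj₁ (weaken w w≥1 ,
    [ (λ 0≤x → inj₂ (0≤⇒≤ (by-certificate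
        (0≤w ⊗ 0≤w ⊗ (b²<K ⊕ 0≤+ {1} ⊕ x≤b ⊗ (weaken b b≥1 ⊕ 0≤x))) (identity (+ k) b w x))))
    , (λ x<0 → inj₁ (0≤⇒≤ (by-certificate (0≤w ⊗ weaken (- x) x<0) (neg w x))))
    ]′ (sign-split x))
    where
    0≤w : 0ℤ ≤ w
    0≤w = weaken w w≥1
    identity : ∀ K b w x → w * w * (K - b * b - 1ℤ + 1ℤ + (b - x) * (b + x)) ≡ w * w * K - w * x * (w * x)
    identity = solve-∀
    neg : ∀ w x → w * - x ≡ 0ℤ - w * x
    neg = solve-∀

  module _ (c : ℕ → ℤ) where

    private
      x : ℕ → Surd
      x = quotient (+ k) c

    -- `recQI` never cancels common factors, so its triples are (m , 1 , t) times a growing factor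
    -- `scale n`. `LeQI` multiplies through by B C, which is `weight n`; its positivity lets the
    -- factor be cancelled from the inequality.
    scale weight : ℕ → ℤ
    scale zero    = 1ℤ
    scale (suc n) = - weight n
    weight n = scale n * (scale n * t (x n))

    complete≡ : ∀ n → complete k c n ≡ (scale n * m (x n) , scale n , scale n * t (x n))
    complete≡ zero    = refl
    complete≡ (suc n) = trans (cong (λ y → recQI k (subQI y (c n))) (complete≡ n))
      (cong₂ _,_ (first (scale n) (c n) (m (x n)) (t (x n)))
        (cong₂ _,_ (second (scale n) (t (x n)))
          (trans (cong (third-lhs (scale n) (c n) (m (x n)) (t (x n))) (quotient-ts (+ k) c n))
            (third (scale n) (c n) (m (x n)) (t (x n)) (s (x n))))))
      where
      first : ∀ μ c m t → μ * t * (μ * m - c * (μ * t)) ≡ - (μ * (μ * t)) * (c * t - m)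
      first = solve-∀
      second : ∀ μ t → - (μ * t * μ) ≡ - (μ * (μ * t))
      second = solve-∀
      third-lhs : ℤ → ℤ → ℤ → ℤ → ℤ → ℤ
      third-lhs μ c m t K = (μ * m - c * (μ * t)) * (μ * m - c * (μ * t)) - μ * μ * K
      third : ∀ μ c m t s →
        (μ * m - c * (μ * t)) * (μ * m - c * (μ * t)) - μ * μ * (t * s + m * m)
          ≡ - (μ * (μ * t)) * (s + + 2 * (c * m) - c * c * t)
      third = solve-∀

    LeQI-complete : ∀ n a → LeQI k a (complete k c n) ≡
      LeSqrt k (weight n * (a * t (x n) - m (x n))) (weight n)
    LeQI-complete n a = trans (cong (LeQI k a) (complete≡ n))
      (cong (λ y → LeSqrt k y (weight n)) (identity (scale n) a (m (x n)) (t (x n))))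
      where
      identity : ∀ μ a m t → a * (μ * t) * (μ * t) - μ * m * (μ * t) ≡ μ * (μ * t) * (a * t - m)
      identity = solve-∀

    weight-step : ∀ n → 0ℤ ≤ weight n - 1ℤ → 0ℤ ≤ t (x (suc n)) - 1ℤ → 0ℤ ≤ weight (suc n) - 1ℤ
    weight-step n w≥1 t≥1 = by-certificate
      (1≤product (weight n * weight n) (t (x (suc n))) (1≤square (weight n) w≥1) t≥1)
      (identity (weight n) (t (x (suc n))))
      where
      identity : ∀ w t → w * w * t - 1ℤ ≡ - w * (- w * t) - 1ℤ
      identity = solve-∀

    isFloor⇒floor : ∀ n → 0ℤ ≤ weight n - 1ℤ →
      IsFloor k (c n) (complete k c n) → Floor b (c n) (m (x n)) (t (x n))
    isFloor⇒floor n w≥1 (_ , c≤x , x<c+1) = record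
      { below = LeSqrt⇒≤ (weight n) (c n * t (x n) - m (x n)) w≥1
          (subst (λ A → A) (LeQI-complete n (c n)) c≤x)
      ; above = by-certificate
          (by-contradiction {x = - (b - ((c n + 1ℤ) * t (x n) - m (x n))) - 1ℤ} λ c+1≤x →
            x<c+1 (subst (λ A → A) (sym (LeQI-complete n (c n + 1ℤ)))
              (≤⇒LeSqrt (weight n) ((c n + 1ℤ) * t (x n) - m (x n)) w≥1
                (by-certificate c+1≤x (double b _)))))
          (rearrange b (c n) (m (x n)) (t (x n)))
      }
      where
      double : ∀ b y → - (- (b - y) - 1ℤ) - 1ℤ ≡ b - y
      double = solve-∀
      rearrange : ∀ b c m t → - (b - ((c + 1ℤ) * t - m)) - 1ℤ ≡ (c + 1ℤ) * t - m - b - 1ℤ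
      rearrange = solve-∀

    floor⇒isFloor : ∀ n → 0ℤ ≤ weight n - 1ℤ →
      Floor b (c n) (m (x n)) (t (x n)) → IsFloor k (c n) (complete k c n)
    floor⇒isFloor n w≥1 fl = subst (λ y → proj₂ (proj₂ y) ≢ 0ℤ) (sym (complete≡ n)) C≢0
      , subst (λ A → A) (sym (LeQI-complete n (c n))) (≤⇒LeSqrt (weight n) (c n * t (x n) - m (x n)) w≥1 below)
      , λ c+1≤x → refute
          (above ⊕ LeSqrt⇒≤ (weight n) ((c n + 1ℤ) * t (x n) - m (x n)) w≥1
            (subst (λ A → A) (LeQI-complete n (c n + 1ℤ)) c+1≤x))
          (identity b (c n) (m (x n)) (t (x n)))
      where
      open Floor fl
      C≢0 : scale n * t (x n) ≢ 0ℤ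
      C≢0 eq = ≥1⇒≢0 w≥1 (trans (cong (scale n *_) eq) (ℤ.*-zeroʳ (scale n)))
      identity : ∀ b c m t → (c + 1ℤ) * t - m - b - 1ℤ + (b - ((c + 1ℤ) * t - m)) ≡ -1ℤ
      identity = solve-∀

    -- The two invariants depend on each other: reading the floor at n as a `Floor` requires a
    -- positive weight, and the next weight is positive because the next `t` is.
    expansion⇒invariant : IsCFExpansionSqrt k c → ∀ n → ReducedAt (+ k) c b n × 0ℤ ≤ weight n - 1ℤ
    expansion⇒invariant cf zero    = √-reduced root , 0≤+
    expansion⇒invariant cf (suc n) with expansion⇒invariant cf n
    ... | red , w≥1 = red′ , weight-step n w≥1 (Reduced.t≥1 red′)
      where red′ = step-reduced root red (isFloor⇒floor n w≥1 (cf n))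

    digits⇒expansion : Digits (+ k) c b → IsCFExpansionSqrt k c
    digits⇒expansion fl n = floor⇒isFloor n (w≥1 n) (fl n)
      where
      w≥1 : ∀ n → 0ℤ ≤ weight n - 1ℤ
      w≥1 zero    = 0≤+
      w≥1 (suc n) = weight-step n (w≥1 n) (Reduced.t≥1 (digits-reduced (+ k) c root fl (suc n)))

    -- The norm of a convergent is ± the next `t`, and t ≤ b + m ≤ 2 b.
    convergent-norm-bound : IsCFExpansionSqrt k c → ∀ j → let (P , Q) = convergent c j in
      ℤ.∣ P * P - + k * (Q * Q) ∣ ℕ.≤ ℤ.∣ b + b ∣
    convergent-norm-bound cf j = ℕ.≤-trans
      (ℕ.≤-reflexive (trans
        (cong (λ (P , Q) → ℤ.∣ P * P - + k * (Q * Q) ∣) (convergent≡ c j)) abs≡))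
       (ℤ.drop‿+≤+ (0≤⇒≤ (subst₂ (λ y z → 0ℤ ≤ y - z)
        (sym (ℤ.0≤i⇒+∣i∣≡i (weaken b b≥1 ⊕ weaken b b≥1))) (sym (ℤ.0≤i⇒+∣i∣≡i 0≤t))
        (by-certificate (t≤b+m ⊕ m≤b) (identity b _ _)))))
      where
      open Reduced (proj₁ (expansion⇒invariant cf (suc j)))
      open NormMatrix (normMatrix (+ k) c (suc j))
      y = x (suc j)
      0≤t : 0ℤ ≤ t y
      0≤t = weaken (t y) t≥1
      abs≡ : ℤ.∣ p c (suc j) * p c (suc j) - + k * (q c (suc j) * q c (suc j)) ∣ ≡ ℤ.∣ t y ∣
      abs≡ = trans (cong ℤ.∣_∣ pp) ([ (λ eq → cong ℤ.∣_∣ (trans (cong (_* t y) eq) (ℤ.*-identityˡ (t y))))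
                                   , (λ eq → trans (cong ℤ.∣_∣ (trans (cong (_* t y) eq) (ℤ.-1*i≡-i (t y)))) (ℤ.∣-i∣≡∣i∣ (t y)))
                                   ]′ (alternating-unit (suc j)))
      identity : ∀ b m t → b + m - t + (b - m) ≡ b + b - t
      identity = solve-∀

-- Existence of the expansion of √k

floorDigit : ℤ → Surd → ℤ
floorDigit b ⟨ m , +[1+ t ] , s ⟩ = (m + b) /ℕ suc t
-- A default value: complete quotients of √K have positive `t`.
floorDigit b ⟨ m , _ , s ⟩ = 0ℤ

-- The two conditions of `Floor` say that the remainder m + b - c t lies between 0 and t - 1.
floorDigit-floor : ∀ b x → 0ℤ ≤ t x - 1ℤ → Floor b (floorDigit b x) (m x) (t x)
floorDigit-floor b ⟨ m , +[1+ t ] , s ⟩ _ = record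
  { below = by-certificate {+ r} 0≤+ (trans (remainder (+ r) c τ) (trans (cong (_- c * τ) (sym a≡)) (rearrange b c m τ)))
  ; above = by-certificate (<⇒0≤ (ℤ.+<+ (n%ℕd<d (m + b) (suc t))))
      (trans (cong (λ z → τ - z - 1ℤ) (trans (remainder (+ r) c τ) (cong (_- c * τ) (sym a≡)))) (rearrange′ b c m τ))
  }
  where
  r = (m + b) %ℕ suc t
  c = (m + b) /ℕ suc t
  τ = +[1+ t ]
  a≡ : m + b ≡ + r + c * τ
  a≡ = a≡a%ℕn+[a/ℕn]*n (m + b) (suc t)
  remainder : ∀ r c t → r ≡ r + c * t - c * t
  remainder = solve-∀
  rearrange : ∀ b c m t → m + b - c * t ≡ b - (c * t - m)
  rearrange = solve-∀
  rearrange′ : ∀ b c m t → t - (m + b - c * t) - 1ℤ ≡ (c + 1ℤ) * t - m - b - 1ℤ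
  rearrange′ = solve-∀
floorDigit-floor b ⟨ m , + zero , s ⟩ ()
floorDigit-floor b ⟨ m , -[1+ t ] , s ⟩ ()

module _ (K b : ℤ) where

  -- Surds and digits are generated together here, since `quotient` presupposes the whole digit
  -- sequence.
  surdAt : ℕ → Surd
  surdAt zero    = ⟨ 0ℤ , 1ℤ , K ⟩
  surdAt (suc n) = step (floorDigit b (surdAt n)) (surdAt n)

  digit : ℕ → ℤ
  digit n = floorDigit b (surdAt n)

  quotient-digit : ∀ n → quotient K digit n ≡ surdAt n
  quotient-digit zero    = refl
  quotient-digit (suc n) = cong (step (digit n)) (quotient-digit n)

  digit-digits : IsRoot K b → Digits K digit b
  digit-digits root n = proj₂ (invariant n)
    where
    floorAt : ∀ n → ReducedAt K digit b n →
      Floor b (digit n) (m (quotient K digit n)) (t (quotient K digit n))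
    floorAt n red = subst (λ x → Floor b (floorDigit b x) (m (quotient K digit n)) (t (quotient K digit n)))
      (quotient-digit n) (floorDigit-floor b (quotient K digit n) (Reduced.t≥1 red))
    invariant : ∀ n → ReducedAt K digit b n × Floor b (digit n) (m (quotient K digit n)) (t (quotient K digit n))
    invariant zero    = √-reduced root , floorAt 0 (√-reduced root)
    invariant (suc n) = red , floorAt (suc n) red
      where red = step-reduced root (proj₁ (invariant n)) (proj₂ (invariant n))

pell⇒convergent : ∀ {k b} → IsRoot (+ k) b → ∀ P Q → 0ℤ ≤ P - 1ℤ → 0ℤ ≤ Q - 1ℤ →
  P * P - + k * (Q * Q) ≡ 1ℤ ⊎ P * P - + k * (Q * Q) ≡ -1ℤ →
  Σ (ℕ → ℤ) λ c → IsCFExpansionSqrt k c ×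
    ∃[ j ] let (P′ , Q′) = convergent c j in (Q′ ≢ 0ℤ × P * Q′ ≡ P′ * Q)
pell⇒convergent {k} {b} root P Q P≥1 Q≥1 norm =
  c , digits⇒expansion root c digits , proj₁ multiple
    , subst (λ x → proj₂ x ≢ 0ℤ × P * proj₂ x ≡ proj₁ x * Q) (sym (convergent≡ c (proj₁ multiple)))
        (proportional (proj₂ multiple))
  where
  c = digit (+ k) b
  digits : Digits (+ k) c b
  digits = digit-digits (+ k) b root
  multiple : IsMultiple root digits {P} {Q}
  multiple = pell-multiple root digits P≥1 Q≥1
    ([ (λ eq → subst (λ z → 0ℤ ≤ z + 1ℤ) (sym eq) 0≤+) , (λ eq → subst (λ z → 0ℤ ≤ z + 1ℤ) (sym eq) 0≤+) ]′ norm)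
    ([ (λ eq → subst (λ z → 0ℤ ≤ 1ℤ - z) (sym eq) 0≤+) , (λ eq → subst (λ z → 0ℤ ≤ 1ℤ - z) (sym eq) 0≤+) ]′ norm)
  proportional : ∀ {p q} → (∃[ w ] (P ≡ w * p × Q ≡ w * q)) → q ≢ 0ℤ × P * q ≡ p * Q
  proportional {p} {q} (w , P≡ , Q≡) =
    (λ q≡0 → ≥1⇒≢0 Q≥1 (trans Q≡ (trans (cong (w *_) q≡0) (ℤ.*-zeroʳ w))))
    , trans (cong (_* q) P≡) (trans (identity w p q) (cong (p *_) (sym Q≡)))
    where
    identity : ∀ w p q → w * p * q ≡ p * (w * q)
    identity = solve-∀

-- The ring ℤ[√K]

Unit : ℤ → Set
Unit ε = ε ≡ 1ℤ ⊎ ε ≡ -1ℤ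

infixl 6 _⊞_

_⊞_ : ∀ {x y} → x ≡ 0ℤ → y ≡ 0ℤ → x + y ≡ 0ℤ
refl ⊞ refl = refl

multiple≡0 : ∀ c {x} → x ≡ 0ℤ → c * x ≡ 0ℤ
multiple≡0 c refl = ℤ.*-zeroʳ c

diff≡0 : ∀ {x y} → x ≡ y → x - y ≡ 0ℤ
diff≡0 {x} refl = ℤ.+-inverseʳ x

≡-from-diff : ∀ {x y} → x - y ≡ 0ℤ → x ≡ y
≡-from-diff = ℤ.i-j≡0⇒i≡j _ _

cancel≡0 : ∀ {x y} → x ≢ 0ℤ → x * y ≡ 0ℤ → y ≡ 0ℤ
cancel≡0 {x} x≢0 eq = [ (λ x≡0 → ⊥-elim (x≢0 x≡0)) , (λ y≡0 → y≡0) ]′ (ℤ.i*j≡0⇒i≡0∨j≡0 x eq)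

*-≢0 : ∀ {x y} → x ≢ 0ℤ → y ≢ 0ℤ → x * y ≢ 0ℤ
*-≢0 x≢0 y≢0 eq = y≢0 (cancel≡0 x≢0 eq)

cancelˡ : ∀ c {x y} → c ≢ 0ℤ → c * x ≡ c * y → x ≡ y
cancelˡ c {x} {y} c≢0 eq = ≡-from-diff (cancel≡0 c≢0 (trans (distrib c x y) (diff≡0 eq)))
  where
  distrib : ∀ c x y → c * (x - y) ≡ c * x - c * y
  distrib = solve-∀

module _ (K : ℤ) where

  mul : ℤ × ℤ → ℤ × ℤ → ℤ × ℤ
  mul (x , y) (x′ , y′) = x * x′ + K * (y * y′) , x * y′ + y * x′

  norm : ℤ × ℤ → ℤ
  norm (x , y) = x * x - K * (y * y)

  pow : ℤ × ℤ → ℕ → ℤ × ℤ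
  pow z zero    = 1ℤ , 0ℤ
  pow z (suc n) = mul z (pow z n)

  mul-assoc : ∀ z z′ z″ → mul (mul z z′) z″ ≡ mul z (mul z′ z″)
  mul-assoc (x , y) (x′ , y′) (x″ , y″) = cong₂ _,_ (first K x y x′ y′ x″ y″) (second K x y x′ y′ x″ y″)
    where
    first : ∀ K x y x′ y′ x″ y″ → (x * x′ + K * (y * y′)) * x″ + K * ((x * y′ + y * x′) * y″)
      ≡ x * (x′ * x″ + K * (y′ * y″)) + K * (y * (x′ * y″ + y′ * x″))
    first = solve-∀
    second : ∀ K x y x′ y′ x″ y″ → (x * x′ + K * (y * y′)) * y″ + (x * y′ + y * x′) * x″
      ≡ x * (x′ * y″ + y′ * x″) + y * (x′ * x″ + K * (y′ * y″))
    second = solve-∀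

  mul-identityˡ : ∀ z → mul (1ℤ , 0ℤ) z ≡ z
  mul-identityˡ (x , y) = cong₂ _,_ (first K x y) (second x y)
    where
    first : ∀ K x y → 1ℤ * x + K * (0ℤ * y) ≡ x
    first = solve-∀
    second : ∀ x y → 1ℤ * y + 0ℤ * x ≡ y
    second = solve-∀

  pow-+ : ∀ z m n → pow z (m ℕ.+ n) ≡ mul (pow z m) (pow z n)
  pow-+ z zero    n = sym (mul-identityˡ (pow z n))
  pow-+ z (suc m) n = trans (cong (mul z) (pow-+ z m n)) (sym (mul-assoc z (pow z m) (pow z n)))

  norm-mul : ∀ z z′ → norm (mul z z′) ≡ norm z * norm z′
  norm-mul (x , y) (x′ , y′) = identity K x y x′ y′
    where
    identity : ∀ K x y x′ y′ →
      (x * x′ + K * (y * y′)) * (x * x′ + K * (y * y′)) - K * ((x * y′ + y * x′) * (x * y′ + y * x′))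
        ≡ (x * x - K * (y * y)) * (x′ * x′ - K * (y′ * y′))
    identity = solve-∀

  norm-pow : ∀ z n → norm (pow z n) ≡ norm z ^ n
  norm-pow z zero    = identity K
    where
    identity : ∀ K → 1ℤ * 1ℤ - K * (0ℤ * 0ℤ) ≡ 1ℤ
    identity = solve-∀
  norm-pow z (suc n) = trans (norm-mul z (pow z n)) (cong (norm z *_) (norm-pow z n))

infix 4 _∥_

_∥_ : ℤ × ℤ → ℤ × ℤ → Set
(x , y) ∥ (u , v) = x * v ≡ u * y

∥-mul : ∀ K {z z′ w w′} → z ∥ w → z′ ∥ w′ → mul K z z′ ∥ mul K w w′
∥-mul K {x , y} {x′ , y′} {u , v} {u′ , v′} p q = ≡-from-diff (trans (identity K x y x′ y′ u v u′ v′)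
  (multiple≡0 (x′ * u′ - K * (y′ * v′)) (diff≡0 p) ⊞ multiple≡0 (x * u - K * (y * v)) (diff≡0 q)))
  where
  identity : ∀ K x y x′ y′ u v u′ v′ →
    (x * x′ + K * (y * y′)) * (u * v′ + v * u′) - (u * u′ + K * (v * v′)) * (x * y′ + y * x′)
      ≡ (x′ * u′ - K * (y′ * v′)) * (x * v - u * y) + (x * u - K * (y * v)) * (x′ * v′ - u′ * y′)
  identity = solve-∀

conj : ℤ × ℤ → ℤ × ℤ
conj (x , y) = x , - y

-- z′ = z z′/z is proportional to w′/w, hence to w′ times the conjugate of w, because the norm of w
-- is rational. Clearing denominators leaves the factor `norm K z` to cancel.
∥-div : ∀ K {z z′ w w′} → norm K z ≢ 0ℤ → z ∥ w → mul K z z′ ∥ w′ → z′ ∥ mul K w′ (conj w)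
∥-div K {x , y} {x′ , y′} {u , v} {u′ , v′} N≢0 p q = ≡-from-diff (cancel≡0 N≢0
  (trans (identity K x y x′ y′ u v u′ v′)
    (multiple≡0 (- ((x * x′ + K * (y * y′)) * u′ - K * ((x * y′ + y * x′) * v′))) (diff≡0 p)
      ⊞ multiple≡0 (x * u - K * (y * v)) (diff≡0 q))))
  where
  identity : ∀ K x y x′ y′ u v u′ v′ →
    (x * x - K * (y * y)) * (x′ * (u′ * - v + v′ * u) - (u′ * u + K * (v′ * - v)) * y′)
      ≡ (- ((x * x′ + K * (y * y′)) * u′ - K * ((x * y′ + y * x′) * v′))) * (x * v - u * y)
        + (x * u - K * (y * v)) * ((x * x′ + K * (y * y′)) * v′ - u′ * (x * y′ + y * x′))
  identity = solve-∀

-- Divisibility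

reduce : ∀ x y → y ≢ 0ℤ → ∃[ t ] ∃[ s ] ∃[ g ]
  (x ≡ t * + g × y ≡ s * + g × + g ≢ 0ℤ × Coprime ℤ.∣ t ∣ ℤ.∣ s ∣)
reduce x y y≢0 with ∣ᵤ⇒∣ {+ gcd ℤ.∣ x ∣ ℤ.∣ y ∣} {x} (gcd[m,n]∣m ℤ.∣ x ∣ ℤ.∣ y ∣)
                  | ∣ᵤ⇒∣ {+ gcd ℤ.∣ x ∣ ℤ.∣ y ∣} {y} (gcd[m,n]∣n ℤ.∣ x ∣ ℤ.∣ y ∣)
... | divides t x≡ | divides s y≡ = t , s , g , x≡ , y≡ , g≢0 , coprime
  where
  g = gcd ℤ.∣ x ∣ ℤ.∣ y ∣
  g≢0 : + g ≢ 0ℤ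
  g≢0 eq = y≢0 (trans y≡ (multiple≡0 s eq))
  abs : ∀ {z r} → z ≡ r * + g → ℤ.∣ r ∣ ℕ.* g ≡ ℤ.∣ z ∣
  abs {z} {r} eq = sym (trans (cong ℤ.∣_∣ eq) (ℤ.∣i*j∣≡∣i∣*∣j∣ r (+ g)))
  coprime : Coprime ℤ.∣ t ∣ ℤ.∣ s ∣
  coprime {i} (i∣t , i∣s) = ∣1⇒≡1 (*-cancelʳ-∣ g {{ℕ.≢-nonZero (λ eq → g≢0 (cong +_ eq))}}
    (subst (i ℕ.* g ∣_) (sym (ℕ.*-identityˡ g))
      (gcd-greatest (subst (i ℕ.* g ∣_) (abs {x} {t} x≡) (*-monoˡ-∣ g i∣t)) (subst (i ℕ.* g ∣_) (abs {y} {s} y≡) (*-monoˡ-∣ g i∣s)))))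

coprime-divides-power : ∀ {s t} → Coprime t s → ∀ n → s ∣ t ℕ.^ n → s ≡ 1
coprime-divides-power cop zero    d = ∣1⇒≡1 d
coprime-divides-power cop (suc n) d =
  coprime-divides-power cop n (coprime-divisor (λ (i∣s , i∣t) → cop (i∣t , i∣s)) d)

abs-^ : ∀ z n → ℤ.∣ z ^ n ∣ ≡ ℤ.∣ z ∣ ℕ.^ n
abs-^ z zero    = refl
abs-^ z (suc n) = trans (ℤ.∣i*j∣≡∣i∣*∣j∣ z (z ^ n)) (cong (ℤ.∣ z ∣ ℕ.*_) (abs-^ z n))

coprime-divides-powerℤ : ∀ {t s} → Coprime ℤ.∣ t ∣ ℤ.∣ s ∣ → ∀ n h → t ^ n ≡ h * s → ℤ.∣ s ∣ ≡ 1
coprime-divides-powerℤ {t} {s} cop n h eq =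
  coprime-divides-power cop n (subst (ℤ.∣ s ∣ ∣_) (abs-^ t n) (∣⇒∣ᵤ (divides h eq)))

abs≡1⇒Unit : ∀ s → ℤ.∣ s ∣ ≡ 1 → Unit s
abs≡1⇒Unit (+ .1)      refl = inj₁ refl
abs≡1⇒Unit (-[1+ .0 ]) refl = inj₂ refl

Unit-square : ∀ {ε} → Unit ε → ε * ε ≡ 1ℤ
Unit-square (inj₁ refl) = refl
Unit-square (inj₂ refl) = refl

Unit-* : ∀ {ε ε′} → Unit ε → Unit ε′ → Unit (ε * ε′)
Unit-* (inj₁ refl) (inj₁ refl) = inj₁ refl
Unit-* (inj₁ refl) (inj₂ refl) = inj₂ refl
Unit-* (inj₂ refl) (inj₁ refl) = inj₂ refl
Unit-* (inj₂ refl) (inj₂ refl) = inj₁ refl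

abs-Unit : ∀ z → ∃[ ε ] (Unit ε × z ≡ ε * + ℤ.∣ z ∣)
abs-Unit (+ n)      = 1ℤ , inj₁ refl , sym (ℤ.*-identityˡ (+ n))
abs-Unit (-[1+ n ]) = -1ℤ , inj₂ refl , sym (ℤ.-1*i≡-i (+ suc n))

abs-square : ∀ t → + ℤ.∣ t ∣ * + ℤ.∣ t ∣ ≡ t * t
abs-square (+ n)      = refl
abs-square (-[1+ n ]) = refl

-- Irrationality of √k: in lowest terms t² = k s² makes s a divisor of t², so s = ±1 and k = t².
norm-nonzero : ∀ {k} → (∀ m → m ℕ.* m ≢ k) → ∀ P Q → Q ≢ 0ℤ → norm (+ k) (P , Q) ≢ 0ℤ
norm-nonzero {k} nonsquare P Q Q≢0 N≡0 with reduce P Q Q≢0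
... | t , s , g , P≡ , Q≡ , g≢0 , cop = nonsquare ℤ.∣ t ∣
  (ℤ.+-injective (trans (ℤ.pos-* ℤ.∣ t ∣ ℤ.∣ t ∣) (trans t²≡ (trans (cong (+ k *_) (Unit-square unit)) (ℤ.*-identityʳ (+ k))))))
  where
  identity : ∀ K t s g → g * g * (t * t - K * (s * s)) ≡ t * g * (t * g) - K * (s * g * (s * g))
  identity = solve-∀
  ts : t * t ≡ + k * (s * s)
  ts = ≡-from-diff (cancel≡0 (*-≢0 g≢0 g≢0) (trans (identity (+ k) t s (+ g))
    (trans (cong₂ (λ P Q → P * P - + k * (Q * Q)) (sym P≡) (sym Q≡)) N≡0)))
  unit : Unit s
  unit = abs≡1⇒Unit s (coprime-divides-powerℤ {t} cop 2 (+ k * s)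
    (trans (cong (t *_) (ℤ.*-identityʳ t)) (trans ts (sym (ℤ.*-assoc (+ k) s s)))))
  t²≡ : + ℤ.∣ t ∣ * + ℤ.∣ t ∣ ≡ + k * (s * s)
  t²≡ = trans (abs-square t) ts

^-≢0 : ∀ {z} n → z ≢ 0ℤ → z ^ n ≢ 0ℤ
^-≢0 zero    z≢0 = λ ()
^-≢0 (suc n) z≢0 = *-≢0 z≢0 (^-≢0 n z≢0)

Unit-≢0 : ∀ {ε} → Unit ε → ε ≢ 0ℤ
Unit-≢0 (inj₁ refl) ()
Unit-≢0 (inj₂ refl) ()

divide : ∀ x r → r ≢ 0 → ∃[ e ] ∃[ h ] (e ℕ.< r × x ≡ + e + h * + r)
divide x zero    r≢0 = ⊥-elim (r≢0 refl)
divide x (suc r) _   = x %ℕ suc r , x /ℕ suc r , n%ℕd<d x (suc r) , a≡a%ℕn+[a/ℕn]*n x (suc r)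

-- Powers of α = a + b√k, where d = a/b: the iterate fⁿ(∞) is x/y for αⁿ = x + y√k.
module Powers {k : ℕ} (nonsquare : ∀ m → m ℕ.* m ≢ k) {a b : ℤ}
  (a≥1 : 0ℤ ≤ a - 1ℤ) (b≥1 : 0ℤ ≤ b - 1ℤ) where

  K N : ℤ
  K = + k
  N = norm K (a , b)

  z : ℕ → ℤ × ℤ
  z = pow K (a , b)

  N≢0 : N ≢ 0ℤ
  N≢0 = norm-nonzero nonsquare a b (≥1⇒≢0 b≥1)

  norm-z≢0 : ∀ n → norm K (z n) ≢ 0ℤ
  norm-z≢0 n eq = ^-≢0 n N≢0 (trans (sym (norm-pow K (a , b) n)) eq)

  z-positive : ∀ n → 0ℤ ≤ proj₁ (z n) - 1ℤ × 0ℤ ≤ proj₂ (z n)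
  z-positive zero    = 0≤+ , 0≤+
  z-positive (suc n) with z-positive n
  ... | x≥1 , y≥0 =
    by-certificate (1≤product a (proj₁ (z n)) a≥1 x≥1 ⊕ 0≤+ {k} ⊗ (weaken b b≥1 ⊗ y≥0))
      (identity (a * proj₁ (z n)) (K * (b * proj₂ (z n))))
    , weaken a a≥1 ⊗ y≥0 ⊕ weaken b b≥1 ⊗ weaken (proj₁ (z n)) x≥1
    where
    identity : ∀ x y → x - 1ℤ + y ≡ x + y - 1ℤ
    identity = solve-∀

  z₂≥1 : ∀ n → 1 ℕ.≤ n → 0ℤ ≤ proj₂ (z n) - 1ℤ
  z₂≥1 (suc n) _ with z-positive n
  ... | x≥1 , y≥0 =
    by-certificate (weaken a a≥1 ⊗ y≥0 ⊕ 1≤product b (proj₁ (z n)) b≥1 x≥1)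
      (identity (a * proj₂ (z n)) (b * proj₁ (z n)))
    where
    identity : ∀ x y → x + (y - 1ℤ) ≡ x + y - 1ℤ
    identity = solve-∀

  Pell : ℕ → Set
  Pell n = ∃[ p ] ∃[ q ] (0 ℕ.< p × 0 ℕ.< q × Unit (norm K (+ p , + q)) × z n ∥ (+ p , + q))

  -- Absolute values preserve proportionality to `z n`, whose coordinates are positive for n ≥ 1. If
  -- X or Y vanished, so would the other, and the norm would be 0.
  unit⇒Pell : ∀ n X Y → 1 ℕ.≤ n → Unit (norm K (X , Y)) → z n ∥ (X , Y) → Pell n
  unit⇒Pell n X Y n≥1 unit par =
    ℤ.∣ X ∣ , ℤ.∣ Y ∣
    , ℕ.n≢0⇒n>0 (λ eq → X≢0 (ℤ.∣i∣≡0⇒i≡0 eq)) , ℕ.n≢0⇒n>0 (λ eq → Y≢0 (ℤ.∣i∣≡0⇒i≡0 eq))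
    , subst Unit (cong₂ (λ x y → x - K * y) (sym (abs-square X)) (sym (abs-square Y))) unit
    , (begin
        A * + ℤ.∣ Y ∣             ≡⟨ cong (_* + ℤ.∣ Y ∣) (sym +A) ⟩
        + ℤ.∣ A ∣ * + ℤ.∣ Y ∣     ≡⟨ sym (ℤ.pos-* ℤ.∣ A ∣ ℤ.∣ Y ∣) ⟩
        + (ℤ.∣ A ∣ ℕ.* ℤ.∣ Y ∣)   ≡⟨ cong +_ (sym (ℤ.∣i*j∣≡∣i∣*∣j∣ A Y)) ⟩
        + ℤ.∣ A * Y ∣             ≡⟨ cong (λ i → + ℤ.∣ i ∣) par ⟩
        + ℤ.∣ X * B ∣             ≡⟨ cong +_ (ℤ.∣i*j∣≡∣i∣*∣j∣ X B) ⟩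
        + (ℤ.∣ X ∣ ℕ.* ℤ.∣ B ∣)   ≡⟨ ℤ.pos-* ℤ.∣ X ∣ ℤ.∣ B ∣ ⟩
        + ℤ.∣ X ∣ * + ℤ.∣ B ∣     ≡⟨ cong (+ ℤ.∣ X ∣ *_) +B ⟩
        + ℤ.∣ X ∣ * B             ∎)
    where
    open ≡-Reasoning
    A = proj₁ (z n)
    B = proj₂ (z n)
    +A : + ℤ.∣ A ∣ ≡ A
    +A = ℤ.0≤i⇒+∣i∣≡i (weaken A (proj₁ (z-positive n)))
    +B : + ℤ.∣ B ∣ ≡ B
    +B = ℤ.0≤i⇒+∣i∣≡i (proj₂ (z-positive n))
    norm-zero : X ≡ 0ℤ → Y ≡ 0ℤ → ⊥
    norm-zero X≡0 Y≡0 = Unit-≢0 unit (trans (cong₂ (λ X Y → X * X - K * (Y * Y)) X≡0 Y≡0) (identity K))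
      where
      identity : ∀ K → 0ℤ * 0ℤ - K * (0ℤ * 0ℤ) ≡ 0ℤ
      identity = solve-∀
    Y≢0 : Y ≢ 0ℤ
    Y≢0 Y≡0 = norm-zero (cancel≡0 {B} (≥1⇒≢0 (z₂≥1 n n≥1))
      (trans (ℤ.*-comm B X) (trans (sym par) (multiple≡0 A Y≡0)))) Y≡0
    X≢0 : X ≢ 0ℤ
    X≢0 X≡0 = Y≢0 (cancel≡0 {A} (≥1⇒≢0 (proj₁ (z-positive n))) (trans par (cong (_* B) X≡0)))

  Pell-+ : ∀ m n → 1 ℕ.≤ m → Pell m → Pell n → Pell (m ℕ.+ n)
  Pell-+ m n m≥1 (p , q , _ , _ , unit , par) (p′ , q′ , _ , _ , unit′ , par′) =
    unit⇒Pell (m ℕ.+ n) (proj₁ w) (proj₂ w) (ℕ.≤-trans m≥1 (ℕ.m≤m+n m n))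
      (subst Unit (sym (norm-mul K (+ p , + q) (+ p′ , + q′))) (Unit-* unit unit′))
      (subst (_∥ w) (sym (pow-+ K (a , b) m n)) (∥-mul K {z m} {z n} {+ p , + q} {+ p′ , + q′} par par′))
    where
    w = mul K (+ p , + q) (+ p′ , + q′)

  Pell-multiples : ∀ n → 1 ℕ.≤ n → Pell n → ∀ i → Pell (suc i ℕ.* n)
  Pell-multiples n n≥1 pell zero    = subst Pell (sym (ℕ.*-identityˡ n)) pell
  Pell-multiples n n≥1 pell (suc i) = Pell-+ n (suc i ℕ.* n) n≥1 pell (Pell-multiples n n≥1 pell i)

  record BoundedPoint (L n : ℕ) : Set where
    field
      P Q      : ℤ
      parallel : z n ∥ (P , Q)
      nonzero  : norm K (P , Q) ≢ 0ℤ
      bounded  : ℤ.∣ norm K (P , Q) ∣ ℕ.≤ L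

  -- Dividing two proportional points that agree modulo their common norm ±ρ
  -- gives a unit of ℤ[√k].
  congruent⇒Pell : ∀ i n {P Q P′ Q′ ε ε′ ρ} h h′ → 1 ℕ.≤ n → ρ ≢ 0ℤ → Unit ε → Unit ε′ →
    z i ∥ (P , Q) → z (i ℕ.+ n) ∥ (P′ , Q′) →
    norm K (P , Q) ≡ ε * ρ → norm K (P′ , Q′) ≡ ε′ * ρ →
    P′ ≡ P + h * ρ → Q′ ≡ Q + h′ * ρ → Pell n
  congruent⇒Pell i n {P} {Q} {P′} {Q′} {ε} {ε′} {ρ} h h′ n≥1 ρ≢0 unit unit′ par par′ nrm nrm′ P≡ Q≡ =
    unit⇒Pell n X Y n≥1 (subst Unit (sym norm≡) (Unit-* unit′ unit)) (cancelˡ ρ ρ≢0 (begin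
      ρ * (A * Y)     ≡⟨ swap ρ A Y ⟩
      A * (ρ * Y)     ≡⟨ cong (A *_) (sym second) ⟩
      A * proj₂ W     ≡⟨ ∥-div K {z i} {z n} {P , Q} {P′ , Q′} (norm-z≢0 i) par
                           (subst (_∥ (P′ , Q′)) (pow-+ K (a , b) i n) par′) ⟩
      proj₁ W * B     ≡⟨ cong (_* B) first ⟩
      ρ * X * B       ≡⟨ ℤ.*-assoc ρ X B ⟩
      ρ * (X * B)     ∎))
    where
    open ≡-Reasoning
    A = proj₁ (z n)
    B = proj₂ (z n)
    W = mul K (P′ , Q′) (conj (P , Q))
    -- X + Y√K is the quotient of W by ρ: substituting P′ and Q′ into W leaves `norm K (P , Q)` = ε
    -- ρ plus terms with the explicit factor ρ.
    X = ε + h * P - K * (h′ * Q)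
    Y = h′ * P - h * Q
    swap : ∀ ρ A Y → ρ * (A * Y) ≡ A * (ρ * Y)
    swap = solve-∀
    first : proj₁ W ≡ ρ * X
    first = begin
      P′ * P + K * (Q′ * - Q)                           ≡⟨ cong₂ (λ x y → x * P + K * (y * - Q)) P≡ Q≡ ⟩
      (P + h * ρ) * P + K * ((Q + h′ * ρ) * - Q)        ≡⟨ expand K P Q h h′ ρ ⟩
      P * P - K * (Q * Q) + ρ * (h * P - K * (h′ * Q))  ≡⟨ cong (_+ ρ * (h * P - K * (h′ * Q))) nrm ⟩
      ε * ρ + ρ * (h * P - K * (h′ * Q))                ≡⟨ collect K P Q h h′ ρ ε ⟩
      ρ * X                                             ∎
      where
      expand : ∀ K P Q h h′ ρ → (P + h * ρ) * P + K * ((Q + h′ * ρ) * - Q)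
        ≡ P * P - K * (Q * Q) + ρ * (h * P - K * (h′ * Q))
      expand = solve-∀
      collect : ∀ K P Q h h′ ρ ε → ε * ρ + ρ * (h * P - K * (h′ * Q)) ≡ ρ * (ε + h * P - K * (h′ * Q))
      collect = solve-∀
    second : proj₂ W ≡ ρ * Y
    second = trans (cong₂ (λ x y → x * - Q + y * P) P≡ Q≡) (expand P Q h h′ ρ)
      where
      expand : ∀ P Q h h′ ρ → (P + h * ρ) * - Q + (Q + h′ * ρ) * P ≡ ρ * (h′ * P - h * Q)
      expand = solve-∀
    norm≡ : norm K (X , Y) ≡ ε′ * ε
    norm≡ = cancelˡ (ρ * ρ) (*-≢0 ρ≢0 ρ≢0) (begin
      ρ * ρ * norm K (X , Y)                     ≡⟨ scaled K ρ X Y ⟩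
      norm K (ρ * X , ρ * Y)                     ≡⟨ cong₂ (λ x y → norm K (x , y)) (sym first) (sym second) ⟩
      norm K W                                   ≡⟨ norm-mul K (P′ , Q′) (conj (P , Q)) ⟩
      norm K (P′ , Q′) * norm K (conj (P , Q))   ≡⟨ cong (norm K (P′ , Q′) *_) (conj-norm K P Q) ⟩
      norm K (P′ , Q′) * norm K (P , Q)          ≡⟨ cong₂ _*_ nrm′ nrm ⟩
      ε′ * ρ * (ε * ρ)                           ≡⟨ regroup ε ε′ ρ ⟩
      ρ * ρ * (ε′ * ε)                           ∎)
      where
      scaled : ∀ K ρ X Y → ρ * ρ * (X * X - K * (Y * Y)) ≡ ρ * X * (ρ * X) - K * (ρ * Y * (ρ * Y))
      scaled = solve-∀
      conj-norm : ∀ K P Q → P * P - K * (- Q * - Q) ≡ P * P - K * (Q * Q)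
      conj-norm = solve-∀
      regroup : ∀ ε ε′ ρ → ε′ * ρ * (ε * ρ) ≡ ρ * ρ * (ε′ * ε)
      regroup = solve-∀

  module _ {L : ℕ} (points : ∀ M → ∃[ n ] (M ℕ.≤ n × BoundedPoint L n)) where

    private
      index : ℕ → ℕ
      chosen : ∀ i → ∃[ n ] BoundedPoint L n
      chosen zero    = let (n , _ , pt) = points 0 in n , pt
      chosen (suc i) = let (n , _ , pt) = points (suc (index i)) in n , pt
      index i = proj₁ (chosen i)

      module Point (i : ℕ) = BoundedPoint (proj₂ (chosen i))

      index-step : ∀ i → index i ℕ.< index (suc i)
      index-step i = proj₁ (proj₂ (points (suc (index i))))

      index-mono : ∀ i j → index i ℕ.< index (suc j ℕ.+ i)
      index-mono i zero    = index-step i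
      index-mono i (suc j) = ℕ.<-trans (index-mono i j) (index-step (suc j ℕ.+ i))

      ρ : ℕ → ℕ
      ρ i = ℤ.∣ norm K (Point.P i , Point.Q i) ∣

      ρ≢0 : ∀ i → ρ i ≢ 0
      ρ≢0 i eq = Point.nonzero i (ℤ.∣i∣≡0⇒i≡0 eq)

      remainder : ℕ → ℤ → ℕ
      remainder i x = proj₁ (divide x (ρ i) (ρ≢0 i))

      ρ<sucL : ∀ i → ρ i ℕ.< suc L
      ρ<sucL i = ℕ.s≤s (Point.bounded i)

      remainder<sucL : ∀ i x → remainder i x ℕ.< suc L
      remainder<sucL i x = ℕ.<-trans (proj₁ (proj₂ (proj₂ (divide x (ρ i) (ρ≢0 i))))) (ρ<sucL i)

      -- The absolute norm is at most L and both residues are smaller than it, so all three numbers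
      -- lie below `suc L`. The sign of the norm is left out of the class: it only decides whether
      -- the resulting unit has norm 1 or -1.
      class : ℕ → Fin (suc L ℕ.* (suc L ℕ.* suc L))
      class i = combine (fromℕ< (ρ<sucL i))
        (combine (fromℕ< (remainder<sucL i (Point.P i))) (fromℕ< (remainder<sucL i (Point.Q i))))

      fromℕ<-injective : ∀ {m n} (m< : m ℕ.< suc L) (n< : n ℕ.< suc L) → fromℕ< m< ≡ fromℕ< n< → m ≡ n
      fromℕ<-injective m< n< eq = trans (sym (toℕ-fromℕ< m<)) (trans (cong toℕ eq) (toℕ-fromℕ< n<))

      same-remainder : ∀ i j x y → ρ i ≡ ρ j → remainder i x ≡ remainder j y → ∃[ h ] y ≡ x + h * + ρ i
      same-remainder i j x y ρ≡ eq with divide x (ρ i) (ρ≢0 i) | divide y (ρ j) (ρ≢0 j)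
      ... | e , u , _ , x≡ | e′ , v , _ , y≡ = v - u , (begin
        y                                    ≡⟨ y≡ ⟩
        + e′ + v * + ρ j                     ≡⟨ cong₂ (λ e r → + e + v * + r) (sym eq) (sym ρ≡) ⟩
        + e + v * + ρ i                      ≡⟨ identity (+ e) u v (+ ρ i) ⟩
        + e + u * + ρ i + (v - u) * + ρ i    ≡⟨ cong (_+ (v - u) * + ρ i) (sym x≡) ⟩
        x + (v - u) * + ρ i                  ∎)
        where
        open ≡-Reasoning
        identity : ∀ e u v r → e + v * r ≡ e + u * r + (v - u) * r
        identity = solve-∀

      same-class : ∀ i j → class i ≡ class j →
        ρ i ≡ ρ j × remainder i (Point.P i) ≡ remainder j (Point.P j) × remainder i (Point.Q i) ≡ remainder j (Point.Q j)
      same-class i j eq =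
        let (eq₁ , eq′)  = combine-injective _ _ _ _ eq
            (eq₂ , eq₃) = combine-injective _ _ _ _ eq′
        in fromℕ<-injective (ρ<sucL i) (ρ<sucL j) eq₁
         , fromℕ<-injective (remainder<sucL i (Point.P i)) (remainder<sucL j (Point.P j)) eq₂
         , fromℕ<-injective (remainder<sucL i (Point.Q i)) (remainder<sucL j (Point.Q j)) eq₃

      fromPair : ∀ i j → index i ℕ.< index j → class i ≡ class j → ∃[ n ] (1 ℕ.≤ n × Pell n)
      fromPair i j i<j eq = n , n≥1 ,
        congruent⇒Pell (index i) n {Point.P i} {Point.Q i} (proj₁ P≡) (proj₁ Q≡) n≥1 (λ eq → ρ≢0 i (ℤ.+-injective eq))
          (proj₁ (proj₂ (abs-Unit rᵢ))) (proj₁ (proj₂ (abs-Unit rⱼ)))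
          (Point.parallel i) (subst (λ l → z l ∥ (Point.P j , Point.Q j)) (sym i+n≡j) (Point.parallel j))
          (proj₂ (proj₂ (abs-Unit rᵢ)))
          (trans (proj₂ (proj₂ (abs-Unit rⱼ))) (cong (λ r → proj₁ (abs-Unit rⱼ) * + r) (sym ρ≡)))
          (proj₂ P≡)
          (proj₂ Q≡)
        where
        n = index j ℕ.∸ index i
        n≥1 : 1 ℕ.≤ n
        n≥1 = ℕ.m<n⇒0<n∸m i<j
        i+n≡j : index i ℕ.+ n ≡ index j
        i+n≡j = ℕ.m+[n∸m]≡n (ℕ.<⇒≤ i<j)
        rᵢ = norm K (Point.P i , Point.Q i)
        rⱼ = norm K (Point.P j , Point.Q j)
        ρ≡ = proj₁ (same-class i j eq)
        P≡ = same-remainder i j (Point.P i) (Point.P j) ρ≡ (proj₁ (proj₂ (same-class i j eq)))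
        Q≡ = same-remainder i j (Point.Q i) (Point.Q j) ρ≡ (proj₂ (proj₂ (same-class i j eq)))

      index-< : ∀ i j → i ℕ.< j → index i ℕ.< index j
      index-< i j i<j = subst (λ l → index i ℕ.< index l)
        (trans (sym (ℕ.+-suc (j ℕ.∸ suc i) i)) (ℕ.m∸n+n≡m i<j)) (index-mono i (j ℕ.∸ suc i))

    bounded⇒Pell : ∃[ n ] (1 ℕ.≤ n × Pell n)
    bounded⇒Pell =
      let (i , j , i<j , eq) = pigeonhole (ℕ.n<1+n _) (λ i → class (toℕ i))
      in fromPair (toℕ i) (toℕ j) (index-< (toℕ i) (toℕ j) i<j) eq

  -- α² = X + Y√k
  X Y : ℤ
  X = a * a + K * (b * b)
  Y = + 2 * (a * b)

  norm-α² : X * X - K * (Y * Y) ≡ N * N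
  norm-α² = identity K a b
    where
    identity : ∀ K a b → (a * a + K * (b * b)) * (a * a + K * (b * b)) - K * (+ 2 * (a * b) * (+ 2 * (a * b)))
      ≡ (a * a - K * (b * b)) * (a * a - K * (b * b))
    identity = solve-∀

  z-double : ∀ n → z (suc n ℕ.* 2) ≡ mul K (X , Y) (z (n ℕ.* 2))
  z-double n = trans (sym (mul-assoc K (a , b) (a , b) (z (n ℕ.* 2))))
    (cong (λ y → mul K (X , y) (z (n ℕ.* 2))) (identity a b))
    where
    identity : ∀ a b → a * b + b * a ≡ + 2 * (a * b)
    identity = solve-∀

  IntegralRatio : Set
  IntegralRatio = ∃[ R ] + 4 * (a * a) ≡ R * (K * (b * b) - a * a)

  -- α²/N is a root of the monic polynomial x² − T x + 1, so the numbers N (α²/N)ⁿ = β n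
  -- stay in ℤ[√k] and have the fixed norm N².
  module _ (T : ℤ) (TN≡2X : T * N ≡ + 2 * X) where

    β : ℕ → ℤ × ℤ
    β zero          = N , 0ℤ
    β (suc zero)    = X , Y
    β (suc (suc n)) = T * proj₁ (β (suc n)) - proj₁ (β n) , T * proj₂ (β (suc n)) - proj₂ (β n)

    Link : ℤ × ℤ → ℤ × ℤ → Set
    Link (x , y) (x′ , y′) = N * x′ ≡ X * x + K * (Y * y) × N * y′ ≡ X * y + Y * x

    -- `Link` says that multiplication by α²/N leads from one term to the next. It persists along
    -- the recurrence because α² has trace 2 X = T N and norm N², so that α⁴ = T N α² - N².
    β-link : ∀ n → Link (β n) (β (suc n))
    β-link zero    = first K N X Y , second N X Y
      where
      first : ∀ K N X Y → N * X ≡ X * N + K * (Y * 0ℤ)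
      first = solve-∀
      second : ∀ N X Y → N * Y ≡ X * 0ℤ + Y * N
      second = solve-∀
    β-link (suc n) =
      ≡-from-diff (cancel≡0 N≢0 (trans (first K N T X Y x y x′ y′)
        (multiple≡0 (N * x′) (diff≡0 TN≡2X) ⊞ multiple≡0 X (diff≡0 ex)
          ⊞ multiple≡0 (- (K * Y)) (diff≡0 ey) ⊞ multiple≡0 x (diff≡0 norm-α²))))
      , ≡-from-diff (cancel≡0 N≢0 (trans (second K N T X Y x y x′ y′)
        (multiple≡0 (N * y′) (diff≡0 TN≡2X) ⊞ multiple≡0 X (diff≡0 ey)
          ⊞ multiple≡0 (- Y) (diff≡0 ex) ⊞ multiple≡0 y (diff≡0 norm-α²))))
      where
      x = proj₁ (β n)
      y = proj₂ (β n)
      x′ = proj₁ (β (suc n))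
      y′ = proj₂ (β (suc n))
      ex = proj₁ (β-link n)
      ey = proj₂ (β-link n)
      first : ∀ K N T X Y x y x′ y′ →
        N * (N * (T * x′ - x) - (X * x′ + K * (Y * y′))) ≡
          N * x′ * (T * N - + 2 * X) + X * (N * x′ - (X * x + K * (Y * y)))
          + - (K * Y) * (N * y′ - (X * y + Y * x)) + x * (X * X - K * (Y * Y) - N * N)
      first = solve-∀
      second : ∀ K N T X Y x y x′ y′ →
        N * (N * (T * y′ - y) - (X * y′ + Y * x′)) ≡
          N * y′ * (T * N - + 2 * X) + X * (N * y′ - (X * y + Y * x))
          + - Y * (N * x′ - (X * x + K * (Y * y))) + y * (X * X - K * (Y * Y) - N * N)
      second = solve-∀

    norm-β : ∀ n → norm K (β n) ≡ N * N
    norm-β zero    = identity K N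
      where
      identity : ∀ K N → N * N - K * (0ℤ * 0ℤ) ≡ N * N
      identity = solve-∀
    norm-β (suc n) = cancelˡ (N * N) (*-≢0 N≢0 N≢0) (begin
      N * N * (x′ * x′ - K * (y′ * y′))                    ≡⟨ scaled K N x′ y′ ⟩
      N * x′ * (N * x′) - K * (N * y′ * (N * y′))          ≡⟨ cong₂ (λ u v → u * u - K * (v * v)) ex ey ⟩
      norm K (mul K (X , Y) (x , y))                       ≡⟨ norm-mul K (X , Y) (x , y) ⟩
      (X * X - K * (Y * Y)) * (x * x - K * (y * y))        ≡⟨ cong₂ _*_ norm-α² (norm-β n) ⟩
      N * N * (N * N)                                      ∎)
      where
      open ≡-Reasoning
      x = proj₁ (β n)
      y = proj₂ (β n)
      x′ = proj₁ (β (suc n))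
      y′ = proj₂ (β (suc n))
      ex = proj₁ (β-link n)
      ey = proj₂ (β-link n)
      scaled : ∀ K N x y → N * N * (x * x - K * (y * y)) ≡ N * x * (N * x) - K * (N * y * (N * y))
      scaled = solve-∀

    β-parallel : ∀ n → z (n ℕ.* 2) ∥ β n
    β-parallel zero    = identity N
      where
      identity : ∀ N → 1ℤ * 0ℤ ≡ N * 0ℤ
      identity = solve-∀
    β-parallel (suc n) = subst (_∥ β (suc n)) (sym (z-double n)) (cancelˡ N N≢0 (begin
      N * ((X * A + K * (Y * B)) * y′)             ≡⟨ swap N (X * A + K * (Y * B)) y′ ⟩
      (X * A + K * (Y * B)) * (N * y′)             ≡⟨ cong ((X * A + K * (Y * B)) *_) ey ⟩
      (X * A + K * (Y * B)) * (X * y + Y * x)      ≡⟨ ≡-from-diff (trans (identity K X Y A B x y)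
                                                        (multiple≡0 (X * X - K * (Y * Y)) (diff≡0 (β-parallel n)))) ⟩
      (X * x + K * (Y * y)) * (X * B + Y * A)      ≡⟨ cong (_* (X * B + Y * A)) (sym ex) ⟩
      N * x′ * (X * B + Y * A)                     ≡⟨ ℤ.*-assoc N x′ (X * B + Y * A) ⟩
      N * (x′ * (X * B + Y * A))                   ∎))
      where
      open ≡-Reasoning
      x = proj₁ (β n)
      y = proj₂ (β n)
      x′ = proj₁ (β (suc n))
      y′ = proj₂ (β (suc n))
      ex = proj₁ (β-link n)
      ey = proj₂ (β-link n)
      A = proj₁ (z (n ℕ.* 2))
      B = proj₂ (z (n ℕ.* 2))
      swap : ∀ N A y → N * (A * y) ≡ A * (N * y)
      swap = solve-∀
      identity : ∀ K X Y A B x y →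
        (X * A + K * (Y * B)) * (X * y + Y * x) - (X * x + K * (Y * y)) * (X * B + Y * A)
        ≡ (X * X - K * (Y * Y)) * (A * y - x * B)
      identity = solve-∀

    β-point : ∀ n → BoundedPoint ℤ.∣ N * N ∣ (n ℕ.* 2)
    β-point n = record
      { P        = proj₁ (β n)
      ; Q        = proj₂ (β n)
      ; parallel = β-parallel n
      ; nonzero  = λ eq → *-≢0 N≢0 N≢0 (trans (sym (norm-β n)) eq)
      ; bounded  = ℕ.≤-reflexive (cong ℤ.∣_∣ (norm-β n))
      }

  ratio⇒Pell : IntegralRatio → ∃[ n ] (1 ℕ.≤ n × Pell n)
  ratio⇒Pell (R , eq) =
    bounded⇒Pell (λ M → M ℕ.* 2 , ℕ.m≤m*n M 2 , β-point (- (R + + 2)) TN≡2X M)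
    where
    identity : ∀ K a b R → - (R + + 2) * (a * a - K * (b * b)) - + 2 * (a * a + K * (b * b))
      ≡ -1ℤ * (+ 4 * (a * a) - R * (K * (b * b) - a * a))
    identity = solve-∀
    TN≡2X : - (R + + 2) * N ≡ + 2 * X
    TN≡2X = ≡-from-diff (trans (identity K a b R) (multiple≡0 -1ℤ (diff≡0 eq)))

  -- With 2X/N = t/s in lowest terms, the trace of (α²/N)ⁿ is W n / sⁿ.  As W n ≡ tⁿ
  -- modulo s, this trace is an integer only if s = ±1.
  module _ (t s g : ℤ) (2X≡ : + 2 * X ≡ t * g) (N≡ : N ≡ s * g) where

    W : ℕ → ℤ
    W zero          = + 2
    W (suc zero)    = t
    W (suc (suc n)) = t * W (suc n) - s * s * W n

    trace : ℕ → ℤ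
    trace n = + 2 * proj₁ (z (n ℕ.* 2))

    -- The equation α⁴ = 2 X α² - N², applied to α to the power 2 n.
    trace-rec : ∀ n → trace (suc (suc n)) ≡ + 2 * X * trace (suc n) - N * N * trace n
    trace-rec n = begin
      + 2 * proj₁ (z (suc (suc n) ℕ.* 2))
        ≡⟨ cong (λ w → + 2 * proj₁ w) (trans (z-double (suc n)) (cong (mul K (X , Y)) (z-double n))) ⟩
      + 2 * (X * (X * A + K * (Y * B)) + K * (Y * (X * B + Y * A)))
        ≡⟨ identity K X Y A B ⟩
      + 2 * X * (+ 2 * (X * A + K * (Y * B))) - (X * X - K * (Y * Y)) * (+ 2 * A)
        ≡⟨ cong₂ (λ u v → + 2 * X * (+ 2 * u) - v * (+ 2 * A)) (sym (cong proj₁ (z-double n))) norm-α² ⟩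
      + 2 * X * trace (suc n) - N * N * trace n  ∎
      where
      open ≡-Reasoning
      A = proj₁ (z (n ℕ.* 2))
      B = proj₂ (z (n ℕ.* 2))
      identity : ∀ K X Y A B → + 2 * (X * (X * A + K * (Y * B)) + K * (Y * (X * B + Y * A)))
        ≡ + 2 * X * (+ 2 * (X * A + K * (Y * B))) - (X * X - K * (Y * Y)) * (+ 2 * A)
      identity = solve-∀

    trace≡ : ∀ n → trace n ≡ g ^ n * W n
    trace≡ zero          = refl
    trace≡ (suc zero)    = trans (start K a b) (trans 2X≡ (regroup t g))
      where
      start : ∀ K a b → + 2 * (a * (a * 1ℤ + K * (b * 0ℤ)) + K * (b * (a * 0ℤ + b * 1ℤ)))
        ≡ + 2 * (a * a + K * (b * b))
      start = solve-∀
      regroup : ∀ t g → t * g ≡ g * 1ℤ * t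
      regroup = solve-∀
    trace≡ (suc (suc n)) = begin
      trace (suc (suc n))                                        ≡⟨ trace-rec n ⟩
      + 2 * X * trace (suc n) - N * N * trace n
        ≡⟨ cong₂ (λ x y → x * trace (suc n) - y * y * trace n) 2X≡ N≡ ⟩
      t * g * trace (suc n) - s * g * (s * g) * trace n
        ≡⟨ cong₂ (λ x y → t * g * x - s * g * (s * g) * y) (trace≡ (suc n)) (trace≡ n) ⟩
      t * g * (g * g ^ n * W (suc n)) - s * g * (s * g) * (g ^ n * W n)
        ≡⟨ regroup t s g (g ^ n) (W (suc n)) (W n) ⟩
      g * (g * g ^ n) * (t * W (suc n) - s * s * W n)            ∎
      where
      open ≡-Reasoning
      regroup : ∀ t s g h w w′ → t * g * (g * h * w) - s * g * (s * g) * (h * w′)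
        ≡ g * (g * h) * (t * w - s * s * w′)
      regroup = solve-∀

    -- The congruence with the powers of t starts at exponent 1, since `W 0` is 2 whereas t⁰ = 1.
    W-mod : ∀ n → ∃[ h ] W (suc n) ≡ t ^ suc n + h * s
    W-mod zero    = 0ℤ , identity t s
      where
      identity : ∀ t s → t ≡ t * 1ℤ + 0ℤ * s
      identity = solve-∀
    W-mod (suc n) with W-mod n
    ... | h , eq = t * h - s * W n ,
      trans (cong (λ w → t * w - s * s * W n) eq) (identity t s h (t ^ suc n) (W n))
      where
      identity : ∀ t s h u w → t * (u + h * s) - s * s * w ≡ t * u + (t * h - s * w) * s
      identity = solve-∀

  -- By proportionality α²ⁿ/Nⁿ = (p + q√K)²/σ, where σ = ±1 is the norm of p + q√K. As 1/σ = σ, its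
  -- trace is the integer V.
  Pell-trace : ∀ n → Pell n → ∃[ V ] + 2 * proj₁ (z (n ℕ.* 2)) ≡ N ^ n * V
  Pell-trace n (p , q , _ , _ , unit , par) = V , (begin
    + 2 * proj₁ (z (n ℕ.* 2))                 ≡⟨ cong (λ i → + 2 * proj₁ (z i)) n*2≡n+n ⟩
    + 2 * proj₁ (z (n ℕ.+ n))                 ≡⟨ cong (λ w → + 2 * proj₁ w) (pow-+ K (a , b) n n) ⟩
    + 2 * (A * A + K * (B * B))               ≡⟨ sym (ℤ.*-identityˡ _) ⟩
    1ℤ * (+ 2 * (A * A + K * (B * B)))        ≡⟨ cong (_* (+ 2 * (A * A + K * (B * B)))) (sym (Unit-square unit)) ⟩
    σ * σ * (+ 2 * (A * A + K * (B * B)))     ≡⟨ ≡-from-diff (trans (identity K A B (+ p) (+ q))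
                                                   (multiple≡0 (- (+ 4 * K * σ * (A * + q + + p * B))) (diff≡0 par))) ⟩
    (A * A - K * (B * B)) * V                 ≡⟨ cong (_* V) (norm-pow K (a , b) n) ⟩
    N ^ n * V                                 ∎)
    where
    open ≡-Reasoning
    A = proj₁ (z n)
    B = proj₂ (z n)
    σ = norm K (+ p , + q)
    V = + 2 * σ * (+ p * + p + K * (+ q * + q))
    n*2≡n+n : n ℕ.* 2 ≡ n ℕ.+ n
    n*2≡n+n = trans (ℕ.*-comm n 2) (cong (n ℕ.+_) (ℕ.+-identityʳ n))
    identity : ∀ K A B p q →
      (p * p - K * (q * q)) * (p * p - K * (q * q)) * (+ 2 * (A * A + K * (B * B)))
        - (A * A - K * (B * B)) * (+ 2 * (p * p - K * (q * q)) * (p * p + K * (q * q)))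
      ≡ - (+ 4 * K * (p * p - K * (q * q)) * (A * q + p * B)) * (A * q - p * B)
    identity = solve-∀

  lowest-terms⇒ratio : ∀ n → Pell (suc n) → ∀ t s g → + 2 * X ≡ t * g → N ≡ s * g → g ≢ 0ℤ →
    Coprime ℤ.∣ t ∣ ℤ.∣ s ∣ → IntegralRatio
  lowest-terms⇒ratio n pell t s g 2X≡ N≡ g≢0 cop =
    -- Once s = ±1, the trace t/s of u equals t s, and R is read off from the trace being -(R + 2).
    - (t * s) - + 2 , ≡-from-diff (trans (identity K a b (t * s)) (multiple≡0 -1ℤ (diff≡0 TN≡2X)))
    where
    open ≡-Reasoning
    V : ℤ
    V = proj₁ (Pell-trace (suc n) pell)
    Wₙ : ℤ
    Wₙ = W t s g 2X≡ N≡ (suc n)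
    ^-distrib : ∀ x y n → (x * y) ^ n ≡ x ^ n * y ^ n
    ^-distrib x y zero    = refl
    ^-distrib x y (suc n) = trans (cong (x * y *_) (^-distrib x y n)) (regroup x y (x ^ n) (y ^ n))
      where
      regroup : ∀ x y u v → x * y * (u * v) ≡ x * u * (y * v)
      regroup = solve-∀
    W≡ : Wₙ ≡ s ^ suc n * V
    W≡ = cancelˡ (g ^ suc n) (^-≢0 (suc n) g≢0) (begin
      g ^ suc n * Wₙ                             ≡⟨ sym (trace≡ t s g 2X≡ N≡ (suc n)) ⟩
      + 2 * proj₁ (z (suc n ℕ.* 2))              ≡⟨ proj₂ (Pell-trace (suc n) pell) ⟩
      N ^ suc n * V                              ≡⟨ cong (λ x → x ^ suc n * V) N≡ ⟩
      (s * g) ^ suc n * V                        ≡⟨ cong (_* V) (^-distrib s g (suc n)) ⟩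
      s ^ suc n * g ^ suc n * V                  ≡⟨ regroup (s ^ suc n) (g ^ suc n) V ⟩
      g ^ suc n * (s ^ suc n * V)                ∎)
      where
      regroup : ∀ x y v → x * y * v ≡ y * (x * v)
      regroup = solve-∀
    divisible : ∀ {w} → w ≡ s ^ suc n * V → (∃[ h ] w ≡ t ^ suc n + h * s) → ∃[ h ] t ^ suc n ≡ h * s
    divisible w≡ (h , w≡′) = s ^ n * V - h , ≡-from-diff (trans
      (rearrange (t ^ suc n) (s ^ n) s V h) (multiple≡0 -1ℤ (diff≡0 (trans (sym w≡) w≡′))))
      where
      rearrange : ∀ u x s v h → u - (x * v - h) * s ≡ -1ℤ * (s * x * v - (u + h * s))
      rearrange = solve-∀
    unit : Unit s
    unit = let (h , eq) = divisible W≡ (W-mod t s g 2X≡ N≡ n)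
           in abs≡1⇒Unit s (coprime-divides-powerℤ {t} cop (suc n) h eq)
    TN≡2X : t * s * N ≡ + 2 * X
    TN≡2X = begin
      t * s * N           ≡⟨ cong (t * s *_) N≡ ⟩
      t * s * (s * g)     ≡⟨ regroup t s g ⟩
      s * s * (t * g)     ≡⟨ cong (_* (t * g)) (Unit-square unit) ⟩
      1ℤ * (t * g)        ≡⟨ ℤ.*-identityˡ (t * g) ⟩
      t * g               ≡⟨ sym 2X≡ ⟩
      + 2 * X             ∎
      where
      regroup : ∀ t s g → t * s * (s * g) ≡ s * s * (t * g)
      regroup = solve-∀
    identity : ∀ K a b T → + 4 * (a * a) - (- T - + 2) * (K * (b * b) - a * a)
      ≡ -1ℤ * (T * (a * a - K * (b * b)) - + 2 * (a * a + K * (b * b)))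
    identity = solve-∀

  Pell⇒ratio : ∃[ n ] (1 ℕ.≤ n × Pell n) → IntegralRatio
  Pell⇒ratio (suc n , _ , pell) =
    let (t , s , g , 2X≡ , N≡ , g≢0 , cop) = reduce (+ 2 * X) N N≢0
    in lowest-terms⇒ratio n pell t s (+ g) 2X≡ N≡ g≢0 cop

-- From ℚ to ℤ

toℚᵘ-ℤ→ℚ : ∀ x → ℚ.toℚᵘ (ℤ→ℚ x) ℚᵘ.≃ mkℚᵘ x 0
toℚᵘ-ℤ→ℚ x = ℚ.toℚᵘ-fromℚᵘ (mkℚᵘ x 0)

ℤ→ℚ-+ : ∀ x y → ℤ→ℚ x ℚ.+ ℤ→ℚ y ≡ ℤ→ℚ (x + y)
ℤ→ℚ-+ x y = ℚ.toℚᵘ-injective (begin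
  ℚ.toℚᵘ (ℤ→ℚ x ℚ.+ ℤ→ℚ y)               ≈⟨ ℚ.toℚᵘ-homo-+ (ℤ→ℚ x) (ℤ→ℚ y) ⟩
  ℚ.toℚᵘ (ℤ→ℚ x) ℚᵘ.+ ℚ.toℚᵘ (ℤ→ℚ y)     ≈⟨ ℚᵘ.+-cong (toℚᵘ-ℤ→ℚ x) (toℚᵘ-ℤ→ℚ y) ⟩
  mkℚᵘ x 0 ℚᵘ.+ mkℚᵘ y 0                 ≈⟨ *≡* (identity x y) ⟩
  mkℚᵘ (x + y) 0                         ≈⟨ ℚᵘ.≃-sym (toℚᵘ-ℤ→ℚ (x + y)) ⟩
  ℚ.toℚᵘ (ℤ→ℚ (x + y))                   ∎)
  where
  open import Relation.Binary.Reasoning.Setoid ℚᵘ.≃-setoid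
  identity : ∀ x y → (x * 1ℤ + y * 1ℤ) * 1ℤ ≡ (x + y) * (1ℤ * 1ℤ)
  identity = solve-∀

ℤ→ℚ-* : ∀ x y → ℤ→ℚ x ℚ.* ℤ→ℚ y ≡ ℤ→ℚ (x * y)
ℤ→ℚ-* x y = ℚ.toℚᵘ-injective (begin
  ℚ.toℚᵘ (ℤ→ℚ x ℚ.* ℤ→ℚ y)               ≈⟨ ℚ.toℚᵘ-homo-* (ℤ→ℚ x) (ℤ→ℚ y) ⟩
  ℚ.toℚᵘ (ℤ→ℚ x) ℚᵘ.* ℚ.toℚᵘ (ℤ→ℚ y)     ≈⟨ ℚᵘ.*-cong (toℚᵘ-ℤ→ℚ x) (toℚᵘ-ℤ→ℚ y) ⟩
  mkℚᵘ x 0 ℚᵘ.* mkℚᵘ y 0                 ≈⟨ *≡* refl ⟩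
  mkℚᵘ (x * y) 0                         ≈⟨ ℚᵘ.≃-sym (toℚᵘ-ℤ→ℚ (x * y)) ⟩
  ℚ.toℚᵘ (ℤ→ℚ (x * y))                   ∎)
  where
  open import Relation.Binary.Reasoning.Setoid ℚᵘ.≃-setoid

ℤ→ℚ-neg : ∀ x → ℚ.- ℤ→ℚ x ≡ ℤ→ℚ (- x)
ℤ→ℚ-neg x = ℚ.toℚᵘ-injective (begin
  ℚ.toℚᵘ (ℚ.- ℤ→ℚ x)       ≈⟨ ℚ.toℚᵘ-homo‿- (ℤ→ℚ x) ⟩
  ℚᵘ.- ℚ.toℚᵘ (ℤ→ℚ x)      ≈⟨ ℚᵘ.-‿cong (toℚᵘ-ℤ→ℚ x) ⟩
  ℚᵘ.- mkℚᵘ x 0            ≈⟨ *≡* refl ⟩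
  mkℚᵘ (- x) 0             ≈⟨ ℚᵘ.≃-sym (toℚᵘ-ℤ→ℚ (- x)) ⟩
  ℚ.toℚᵘ (ℤ→ℚ (- x))       ∎)
  where
  open import Relation.Binary.Reasoning.Setoid ℚᵘ.≃-setoid

ℤ→ℚ-injective : ∀ {x y} → ℤ→ℚ x ≡ ℤ→ℚ y → x ≡ y
ℤ→ℚ-injective {x} {y} eq with ℚ.fromℚᵘ-injective {mkℚᵘ x 0} {mkℚᵘ y 0} eq
... | *≡* eq′ = trans (sym (ℤ.*-identityʳ x)) (trans eq′ (ℤ.*-identityʳ y))

ℚ-cancelʳ : ∀ {u v c} → c ≢ 0ℚ → u ℚ.* c ≡ v ℚ.* c → u ≡ v
ℚ-cancelʳ {u} {v} {c} c≢0 eq = begin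
  u                        ≡⟨ expand u ⟩
  u ℚ.* c ℚ.* (ℚ.1/ c)     ≡⟨ cong (ℚ._* (ℚ.1/ c)) eq ⟩
  v ℚ.* c ℚ.* (ℚ.1/ c)     ≡⟨ sym (expand v) ⟩
  v                        ∎
  where
  open ≡-Reasoning
  instance
    c-nonZero : ℚ.NonZero c
    c-nonZero = ℚ.≢-nonZero c≢0
  expand : ∀ w → w ≡ w ℚ.* c ℚ.* (ℚ.1/ c)
  expand w = sym (trans (ℚ.*-assoc w c (ℚ.1/ c)) (trans (cong (w ℚ.*_) (ℚ.*-inverseʳ c)) (ℚ.*-identityʳ w)))

*-denominator : ∀ d → d ℚ.* ℤ→ℚ (ℚ.↧ d) ≡ ℤ→ℚ (ℚ.↥ d)
*-denominator d@(mkℚ n e-1 _) = ℚ.toℚᵘ-injective (begin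
  ℚ.toℚᵘ (d ℚ.* ℤ→ℚ +[1+ e-1 ])              ≈⟨ ℚ.toℚᵘ-homo-* d (ℤ→ℚ +[1+ e-1 ]) ⟩
  mkℚᵘ n e-1 ℚᵘ.* ℚ.toℚᵘ (ℤ→ℚ +[1+ e-1 ])    ≈⟨ ℚᵘ.*-cong (ℚᵘ.≃-refl {mkℚᵘ n e-1}) (toℚᵘ-ℤ→ℚ +[1+ e-1 ]) ⟩
  mkℚᵘ n e-1 ℚᵘ.* mkℚᵘ +[1+ e-1 ] 0          ≈⟨ *≡* (identity n +[1+ e-1 ]) ⟩
  mkℚᵘ n 0                                   ≈⟨ ℚᵘ.≃-sym (toℚᵘ-ℤ→ℚ n) ⟩
  ℚ.toℚᵘ (ℤ→ℚ n)                             ∎)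
  where
  open import Relation.Binary.Reasoning.Setoid ℚᵘ.≃-setoid
  identity : ∀ n e → n * e * 1ℤ ≡ n * (e * 1ℤ)
  identity = solve-∀

-- The integer part of √k

isqrt : ∀ n → ∃[ r ] (r ℕ.* r ℕ.≤ n × n ℕ.< suc r ℕ.* suc r)
isqrt zero    = 0 , ℕ.z≤n , ℕ.s≤s ℕ.z≤n
isqrt (suc n) with isqrt n
... | r , r²≤n , n<sr² with suc n ℕ.<? suc r ℕ.* suc r
...   | yes sn<sr² = r , ℕ.m≤n⇒m≤1+n r²≤n , sn<sr²
...   | no  sn≮sr² = suc r , ℕ.≮⇒≥ sn≮sr² , ℕ.≤-<-trans n<sr² (ℕ.*-mono-< (ℕ.n<1+n (suc r)) (ℕ.n<1+n (suc r)))

root-exists : ∀ k → 1 ℕ.≤ k → (∀ m → m ℕ.* m ≢ k) → ∃[ b ] IsRoot (+ k) b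
root-exists k 1≤k nonsquare with isqrt k
... | zero , _ , k<1 = ⊥-elim (ℕ.<⇒≱ k<1 1≤k)
... | r@(suc _) , r²≤k , k<sr² = + r , record
  { b≥1  = 0≤+
  ; b²<K = subst (λ y → 0ℤ ≤ + k - y - 1ℤ) (ℤ.pos-* r r) (<⇒0≤ (ℤ.+<+ (ℕ.≤∧≢⇒< r²≤k (nonsquare r))))
  ; K<   = subst (λ y → 0ℤ ≤ y - + k - 1ℤ)
      (trans (ℤ.pos-* (suc r) (suc r)) (cong (λ y → y * y) (ℤ.+-comm 1ℤ (+ r)))) (<⇒0≤ (ℤ.+<+ k<sr²))
  }

pos≥1 : ∀ {n} → 0 ℕ.< n → 0ℤ ≤ + n - 1ℤ
pos≥1 {suc n} _ = 0≤+

-- Transfer to the iterates of f over ℚ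

module Iteration {k : ℕ} (1≤k : 1 ℕ.≤ k) (nonsquare : ∀ m → m ℕ.* m ≢ k)
  {d : ℚ} {a b : ℤ} (a≥1 : 0ℤ ≤ a - 1ℤ) (b≥1 : 0ℤ ≤ b - 1ℤ) (db≡a : d ℚ.* ℤ→ℚ b ≡ ℤ→ℚ a) where
  open Powers nonsquare {a} {b} a≥1 b≥1
  open +-*-Solver using (_:*_; _:+_; _:-_; _:=_) renaming (solve to solveℚ)

  private
    x y scaling : ℕ → ℚ
    x n = proj₁ (fIter k d n)
    y n = proj₂ (fIter k d n)
    scaling n = ℤ→ℚ (b ^ n)

  scaling≢0 : ∀ n → scaling n ≢ 0ℚ
  scaling≢0 n eq = ^-≢0 n (≥1⇒≢0 b≥1) (ℤ→ℚ-injective eq)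

  -- The matrix of f multiplied by b is the matrix of multiplication by a + b√k, so n iterations
  -- account for the factor bⁿ.
  fIter-scaled : ∀ n → x n ℚ.* scaling n ≡ ℤ→ℚ (proj₁ (z n)) × y n ℚ.* scaling n ≡ ℤ→ℚ (proj₂ (z n))
  fIter-scaled zero    = refl , refl
  fIter-scaled (suc n) = (begin
      (d ℚ.* x n ℚ.+ ℤ→ℚ K ℚ.* y n) ℚ.* ℤ→ℚ (b * b ^ n)
        ≡⟨ cong ((d ℚ.* x n ℚ.+ ℤ→ℚ K ℚ.* y n) ℚ.*_) (sym (ℤ→ℚ-* b (b ^ n))) ⟩
      (d ℚ.* x n ℚ.+ ℤ→ℚ K ℚ.* y n) ℚ.* (ℤ→ℚ b ℚ.* scaling n)
        ≡⟨ regroup d (x n) (y n) (ℤ→ℚ K) (ℤ→ℚ b) (scaling n) ⟩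
      d ℚ.* ℤ→ℚ b ℚ.* (x n ℚ.* scaling n) ℚ.+ ℤ→ℚ K ℚ.* (ℤ→ℚ b ℚ.* (y n ℚ.* scaling n))
        ≡⟨ cong₂ ℚ._+_ (cong₂ ℚ._*_ db≡a ex) (cong (λ w → ℤ→ℚ K ℚ.* (ℤ→ℚ b ℚ.* w)) ey) ⟩
      ℤ→ℚ a ℚ.* ℤ→ℚ A ℚ.+ ℤ→ℚ K ℚ.* (ℤ→ℚ b ℚ.* ℤ→ℚ B)
        ≡⟨ cong₂ ℚ._+_ (ℤ→ℚ-* a A) (trans (cong (ℤ→ℚ K ℚ.*_) (ℤ→ℚ-* b B)) (ℤ→ℚ-* K (b * B))) ⟩
      ℤ→ℚ (a * A) ℚ.+ ℤ→ℚ (K * (b * B))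
        ≡⟨ ℤ→ℚ-+ (a * A) (K * (b * B)) ⟩
      ℤ→ℚ (a * A + K * (b * B))  ∎)
    , (begin
      (x n ℚ.+ d ℚ.* y n) ℚ.* ℤ→ℚ (b * b ^ n)
        ≡⟨ cong ((x n ℚ.+ d ℚ.* y n) ℚ.*_) (sym (ℤ→ℚ-* b (b ^ n))) ⟩
      (x n ℚ.+ d ℚ.* y n) ℚ.* (ℤ→ℚ b ℚ.* scaling n)
        ≡⟨ regroup′ d (x n) (y n) (ℤ→ℚ b) (scaling n) ⟩
      d ℚ.* ℤ→ℚ b ℚ.* (y n ℚ.* scaling n) ℚ.+ ℤ→ℚ b ℚ.* (x n ℚ.* scaling n)
        ≡⟨ cong₂ ℚ._+_ (cong₂ ℚ._*_ db≡a ey) (cong (ℤ→ℚ b ℚ.*_) ex) ⟩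
      ℤ→ℚ a ℚ.* ℤ→ℚ B ℚ.+ ℤ→ℚ b ℚ.* ℤ→ℚ A
        ≡⟨ cong₂ ℚ._+_ (ℤ→ℚ-* a B) (ℤ→ℚ-* b A) ⟩
      ℤ→ℚ (a * B) ℚ.+ ℤ→ℚ (b * A)
        ≡⟨ ℤ→ℚ-+ (a * B) (b * A) ⟩
      ℤ→ℚ (a * B + b * A)  ∎)
    where
    open ≡-Reasoning
    A = proj₁ (z n)
    B = proj₂ (z n)
    ex = proj₁ (fIter-scaled n)
    ey = proj₂ (fIter-scaled n)
    regroup : ∀ d x y K b c → (d ℚ.* x ℚ.+ K ℚ.* y) ℚ.* (b ℚ.* c)
      ≡ d ℚ.* b ℚ.* (x ℚ.* c) ℚ.+ K ℚ.* (b ℚ.* (y ℚ.* c))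
    regroup = solveℚ 6 (λ d x y K b c → (d :* x :+ K :* y) :* (b :* c)
      := d :* b :* (x :* c) :+ K :* (b :* (y :* c))) refl
    regroup′ : ∀ d x y b c → (x ℚ.+ d ℚ.* y) ℚ.* (b ℚ.* c) ≡ d ℚ.* b ℚ.* (y ℚ.* c) ℚ.+ b ℚ.* (x ℚ.* c)
    regroup′ = solveℚ 5 (λ d x y b c → (x :+ d :* y) :* (b :* c) := d :* b :* (y :* c) :+ b :* (x :* c)) refl

  scaled-cross : ∀ n P Q → x n ℚ.* ℤ→ℚ Q ℚ.* scaling n ≡ ℤ→ℚ (proj₁ (z n) * Q)
    × ℤ→ℚ P ℚ.* y n ℚ.* scaling n ≡ ℤ→ℚ (P * proj₂ (z n))
  scaled-cross n P Q =
      trans (swap (x n) (ℤ→ℚ Q) (scaling n))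
        (trans (cong (ℚ._* ℤ→ℚ Q) (proj₁ (fIter-scaled n))) (ℤ→ℚ-* (proj₁ (z n)) Q))
    , trans (ℚ.*-assoc (ℤ→ℚ P) (y n) (scaling n))
        (trans (cong (ℤ→ℚ P ℚ.*_) (proj₂ (fIter-scaled n))) (ℤ→ℚ-* P (proj₂ (z n))))
    where
    swap : ∀ x q c → x ℚ.* q ℚ.* c ≡ x ℚ.* c ℚ.* q
    swap = solveℚ 3 (λ x q c → x :* q :* c := x :* c :* q) refl

  PointEq⇒∥ : ∀ n P Q → PointEq (fIter k d n) P Q → z n ∥ (P , Q)
  PointEq⇒∥ n P Q (_ , _ , eq) = ℤ→ℚ-injective (trans (sym (proj₁ (scaled-cross n P Q)))
    (trans (cong (ℚ._* scaling n) eq) (proj₂ (scaled-cross n P Q))))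

  ∥⇒PointEq : ∀ n P Q → 1 ℕ.≤ n → Q ≢ 0ℤ → z n ∥ (P , Q) → PointEq (fIter k d n) P Q
  ∥⇒PointEq n P Q n≥1 Q≢0 par = y≢0 , Q≢0 , ℚ-cancelʳ (scaling≢0 n)
    (trans (proj₁ (scaled-cross n P Q)) (trans (cong ℤ→ℚ par) (sym (proj₂ (scaled-cross n P Q)))))
    where
    y≢0 : y n ≢ 0ℚ
    y≢0 eq = ≥1⇒≢0 {proj₂ (z n)} (z₂≥1 n n≥1) (ℤ→ℚ-injective (trans (sym (proj₂ (fIter-scaled n)))
      (trans (cong (ℚ._* scaling n) eq) (ℚ.*-zeroˡ (scaling n)))))

  Pellian : Set
  Pellian = ∃[ n ] (1 ℕ.≤ n × IsPellian k (fIter k d n))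

  Pellian⇒Pell : Pellian → ∃[ n ] (1 ℕ.≤ n × Pell n)
  Pellian⇒Pell (n , n≥1 , p , q , p>0 , q>0 , unit , pt) =
    n , n≥1 , p , q , p>0 , q>0 , unit , PointEq⇒∥ n (+ p) (+ q) pt

  Pell⇒Pellian : ∃[ n ] (1 ℕ.≤ n × Pell n) → Pellian
  Pell⇒Pellian (n , n≥1 , p , q , p>0 , q>0 , unit , par) =
    n , n≥1 , p , q , p>0 , q>0 , unit , ∥⇒PointEq n (+ p) (+ q) n≥1 (≥1⇒≢0 (pos≥1 q>0)) par

  convergent⇒point : ∀ {β} → IsRoot K β → ∀ n → IsConvergentSqrt k (fIter k d n) →
    BoundedPoint ℤ.∣ β + β ∣ n
  convergent⇒point root n (c , cf , j , pt) = record
    { P        = proj₁ (convergent c j)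
    ; Q        = proj₂ (convergent c j)
    ; parallel = PointEq⇒∥ n (proj₁ (convergent c j)) (proj₂ (convergent c j)) pt
    ; nonzero  = norm-nonzero nonsquare (proj₁ (convergent c j)) (proj₂ (convergent c j)) (proj₁ (proj₂ pt))
    ; bounded  = convergent-norm-bound root c cf j
    }

  Pell⇒convergent : ∀ {β} → IsRoot K β → ∀ n → 1 ℕ.≤ n → Pell n → IsConvergentSqrt k (fIter k d n)
  Pell⇒convergent root n n≥1 (p , q , p>0 , q>0 , unit , par) =
    let (c , cf , j , Q≢0 , cross) = pell⇒convergent root (+ p) (+ q) (pos≥1 p>0) (pos≥1 q>0) unit
    in c , cf , j , ∥⇒PointEq n (proj₁ (convergent c j)) (proj₂ (convergent c j)) n≥1 Q≢0
         (∥-trans {proj₁ (convergent c j)} {proj₂ (convergent c j)} cross)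
    where
    open ≡-Reasoning
    A = proj₁ (z n)
    B = proj₂ (z n)
    ∥-trans : ∀ {P Q} → + p * Q ≡ P * + q → A * Q ≡ P * B
    ∥-trans {P} {Q} cross = cancelˡ (+ q) (≥1⇒≢0 (pos≥1 q>0)) (begin
      + q * (A * Q)   ≡⟨ regroup (+ q) A Q ⟩
      A * + q * Q     ≡⟨ cong (_* Q) par ⟩
      + p * B * Q     ≡⟨ regroup′ (+ p) B Q ⟩
      + p * Q * B     ≡⟨ cong (_* B) cross ⟩
      P * + q * B     ≡⟨ regroup″ P (+ q) B ⟩
      + q * (P * B)   ∎)
      where
      regroup : ∀ q A Q → q * (A * Q) ≡ A * q * Q
      regroup = solve-∀
      regroup′ : ∀ p B Q → p * B * Q ≡ p * Q * B
      regroup′ = solve-∀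
      regroup″ : ∀ P q B → P * q * B ≡ q * (P * B)
      regroup″ = solve-∀

  InfinitelyManyConvergents : Set
  InfinitelyManyConvergents = ∀ M → ∃[ n ] (M ℕ.≤ n × (1 ℕ.≤ n × IsConvergentSqrt k (fIter k d n)))

  Pellian⇔convergents : Pellian ⇔ InfinitelyManyConvergents
  Pellian⇔convergents = mk⇔
    (λ pellian M → let (n , n≥1 , pell) = Pellian⇒Pell pellian
                       Mn≥1 = ℕ.≤-trans n≥1 (ℕ.m≤m+n n (M ℕ.* n))
                   -- The powers of the unit at exponent n sit at the multiples of n; as n ≥ 1, the
                   -- multiple (M + 1) n is beyond M.
                   in suc M ℕ.* n
                    , ℕ.≤-trans (ℕ.n≤1+n M) (ℕ.m≤m*n (suc M) n {{ℕ.>-nonZero n≥1}})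
                    , Mn≥1
                    , Pell⇒convergent root (suc M ℕ.* n) Mn≥1 (Pell-multiples n n≥1 pell M))
    (λ convergents → Pell⇒Pellian (bounded⇒Pell λ M →
      let (n , M≤n , _ , conv) = convergents M in n , M≤n , convergent⇒point root n conv))
    where
    root : IsRoot K (proj₁ (root-exists k 1≤k nonsquare))
    root = proj₂ (root-exists k 1≤k nonsquare)

  RationalRatio : Set
  RationalRatio = ∃[ R ] ℕ→ℚ 4 ℚ.* d ℚ.* d ≡ ℤ→ℚ R ℚ.* (ℕ→ℚ k ℚ.- d ℚ.* d)

  scaled-ratio : ∀ R →
    ℕ→ℚ 4 ℚ.* d ℚ.* d ℚ.* (ℤ→ℚ b ℚ.* ℤ→ℚ b) ≡ ℤ→ℚ (+ 4 * (a * a)) ×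
    ℤ→ℚ R ℚ.* (ℕ→ℚ k ℚ.- d ℚ.* d) ℚ.* (ℤ→ℚ b ℚ.* ℤ→ℚ b) ≡ ℤ→ℚ (R * (K * (b * b) - a * a))
  scaled-ratio R = (begin
      ℕ→ℚ 4 ℚ.* d ℚ.* d ℚ.* (ℤ→ℚ b ℚ.* ℤ→ℚ b)
        ≡⟨ regroup (ℕ→ℚ 4) d (ℤ→ℚ b) ⟩
      ℕ→ℚ 4 ℚ.* (d ℚ.* ℤ→ℚ b ℚ.* (d ℚ.* ℤ→ℚ b))
        ≡⟨ cong (λ w → ℕ→ℚ 4 ℚ.* (w ℚ.* w)) db≡a ⟩
      ℤ→ℚ (+ 4) ℚ.* (ℤ→ℚ a ℚ.* ℤ→ℚ a)
        ≡⟨ trans (cong (ℤ→ℚ (+ 4) ℚ.*_) (ℤ→ℚ-* a a)) (ℤ→ℚ-* (+ 4) (a * a)) ⟩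
      ℤ→ℚ (+ 4 * (a * a))  ∎)
    , (begin
      ℤ→ℚ R ℚ.* (ℕ→ℚ k ℚ.- d ℚ.* d) ℚ.* (ℤ→ℚ b ℚ.* ℤ→ℚ b)
        ≡⟨ regroup′ (ℤ→ℚ R) (ℕ→ℚ k) d (ℤ→ℚ b) ⟩
      ℤ→ℚ R ℚ.* (ℤ→ℚ K ℚ.* (ℤ→ℚ b ℚ.* ℤ→ℚ b) ℚ.- d ℚ.* ℤ→ℚ b ℚ.* (d ℚ.* ℤ→ℚ b))
        ≡⟨ cong (λ w → ℤ→ℚ R ℚ.* (ℤ→ℚ K ℚ.* (ℤ→ℚ b ℚ.* ℤ→ℚ b) ℚ.- w ℚ.* w)) db≡a ⟩
      ℤ→ℚ R ℚ.* (ℤ→ℚ K ℚ.* (ℤ→ℚ b ℚ.* ℤ→ℚ b) ℚ.- ℤ→ℚ a ℚ.* ℤ→ℚ a)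
        ≡⟨ cong₂ (λ u v → ℤ→ℚ R ℚ.* (u ℚ.- v))
             (trans (cong (ℤ→ℚ K ℚ.*_) (ℤ→ℚ-* b b)) (ℤ→ℚ-* K (b * b))) (ℤ→ℚ-* a a) ⟩
      ℤ→ℚ R ℚ.* (ℤ→ℚ (K * (b * b)) ℚ.- ℤ→ℚ (a * a))
        ≡⟨ cong (λ w → ℤ→ℚ R ℚ.* (ℤ→ℚ (K * (b * b)) ℚ.+ w)) (ℤ→ℚ-neg (a * a)) ⟩
      ℤ→ℚ R ℚ.* (ℤ→ℚ (K * (b * b)) ℚ.+ ℤ→ℚ (- (a * a)))
        ≡⟨ trans (cong (ℤ→ℚ R ℚ.*_) (ℤ→ℚ-+ (K * (b * b)) (- (a * a)))) (ℤ→ℚ-* R (K * (b * b) - a * a)) ⟩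
      ℤ→ℚ (R * (K * (b * b) - a * a))  ∎)
    where
    open ≡-Reasoning
    regroup : ∀ f d b → f ℚ.* d ℚ.* d ℚ.* (b ℚ.* b) ≡ f ℚ.* (d ℚ.* b ℚ.* (d ℚ.* b))
    regroup = solveℚ 3 (λ f d b → f :* d :* d :* (b :* b) := f :* (d :* b :* (d :* b))) refl
    regroup′ : ∀ r k d b → r ℚ.* (k ℚ.- d ℚ.* d) ℚ.* (b ℚ.* b)
      ≡ r ℚ.* (k ℚ.* (b ℚ.* b) ℚ.- d ℚ.* b ℚ.* (d ℚ.* b))
    regroup′ = solveℚ 4 (λ r k d b → r :* (k :- d :* d) :* (b :* b)
      := r :* (k :* (b :* b) :- d :* b :* (d :* b))) refl

  rational⇒integral : ∀ R → ℕ→ℚ 4 ℚ.* d ℚ.* d ≡ ℤ→ℚ R ℚ.* (ℕ→ℚ k ℚ.- d ℚ.* d) →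
    + 4 * (a * a) ≡ R * (K * (b * b) - a * a)
  rational⇒integral R eq = ℤ→ℚ-injective {+ 4 * (a * a)} {R * (K * (b * b) - a * a)}
    (trans (sym (proj₁ (scaled-ratio R)))
      (trans (cong (ℚ._* (ℤ→ℚ b ℚ.* ℤ→ℚ b)) eq) (proj₂ (scaled-ratio R))))

  integral⇒rational : ∀ R → + 4 * (a * a) ≡ R * (K * (b * b) - a * a) →
    ℕ→ℚ 4 ℚ.* d ℚ.* d ≡ ℤ→ℚ R ℚ.* (ℕ→ℚ k ℚ.- d ℚ.* d)
  integral⇒rational R eq = ℚ-cancelʳ {c = ℤ→ℚ b ℚ.* ℤ→ℚ b} b²≢0
    (trans (proj₁ (scaled-ratio R)) (trans (cong ℤ→ℚ eq) (sym (proj₂ (scaled-ratio R)))))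
    where
    b²≢0 : ℤ→ℚ b ℚ.* ℤ→ℚ b ≢ 0ℚ
    b²≢0 eq = *-≢0 {b} {b} (≥1⇒≢0 b≥1) (≥1⇒≢0 b≥1) (ℤ→ℚ-injective (trans (sym (ℤ→ℚ-* b b)) eq))

  ratio⇔Pellian : RationalRatio ⇔ Pellian
  ratio⇔Pellian = mk⇔
    (λ (R , eq) → Pell⇒Pellian (ratio⇒Pell (R , rational⇒integral R eq)))
    (λ pellian → let (R , eq) = Pell⇒ratio (Pellian⇒Pell pellian) in R , integral⇒rational R eq)

theorem2p2 : (k : ℕ) → 1 ℕ.≤ k → (∀ m → m ℕ.* m ≢ k) →
    (d : ℚ) → ℚ.0ℚ ℚ.< d →
    ((∃[ R ] ℕ→ℚ 4 ℚ.* d ℚ.* d ≡ ℤ→ℚ R ℚ.* (ℕ→ℚ k ℚ.- d ℚ.* d))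
    ⇔ (∃[ n ] (1 ℕ.≤ n × IsPellian k (fIter k d n))))
    × ((∃[ n ] (1 ℕ.≤ n × IsPellian k (fIter k d n)))
    ⇔ (∀ N → ∃[ n ] (N ℕ.≤ n × (1 ℕ.≤ n × IsConvergentSqrt k (fIter k d n)))))
theorem2p2 k 1≤k nonsquare d 0<d = ratio⇔Pellian , Pellian⇔convergents
  where
  numerator≥1 : ∀ d → 0ℚ ℚ.< d → 0ℤ ≤ ℚ.↥ d - 1ℤ
  numerator≥1 (mkℚ n _ _) (ℚ.*<* 0<n) = by-certificate
    (<⇒0≤ (subst₂ _<_ refl (ℤ.*-identityʳ n) 0<n)) (cong (_- 1ℤ) (ℤ.+-identityʳ n))
  open Iteration {k} 1≤k nonsquare {d} {ℚ.↥ d} {ℚ.↧ d} (numerator≥1 d 0<d) 0≤+ (*-denominator d)
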